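{- Let $p<q$ be primes, and consider the polynomial $I(\varGamma(\mathbb{Z}_{pq}),x)$. (1) If $p$ and $q$ are odd primes, then $I(\varGamma(\mathbb{Z}_{pq}),x)$ has exactly two real zeros, one in the interval $(-1,0)$ and another in $(-2,-1)$. (2) If $p=2$ and $q$ is an odd prime, then $I(\varGamma(\mathbb{Z}_{pq}),x)$ has exactly two real zeros, one in the interval $(-1,0)$ and another in $(-3,-2)$.
   Context: For a positive integer $n$, the zero divisor graph $\varGamma(\mathbb{Z}_n)$ is the simple undirected graph whose vertices are the non-zero zero divisors of the ring $\mathbb{Z}_n$ of integers modulo $n$ (non-zero $a$ such that $ab=0$ for some non-zero $b$), two distinct vertices $a,b$ being adjacent if and only if $ab=0$ in $\mathbb{Z}_n$. An independent set of a finite graph $G$ is a set of vertices no two of which are adjacent (the empty set included); $\alpha(G)$ is the maximum size of an independent set, and $s_k(G)$ is the number of independent sets of size $k$. The independence polynomial of $G$ is $I(G,x)=\sum_{k=0}^{\alpha(G)} s_k(G)x^k$. -}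

module Defs where

open import Data.Bool.Base using (true; false)
open import Data.Fin.Base using (Fin; toℕ)
open import Data.Fin.Properties using (all?; any?; nonZeroIndex) renaming (_≟_ to _≟ᶠ_)
open import Data.Fin.Subset using (Subset; inside; outside; _∈_; ∣_∣)
open import Data.Fin.Subset.Properties using (_∈?_)
open import Data.Integer.Base using (ℤ; +_)
open import Data.List.Base using (List; []; _∷_; _++_; map; filter; length; foldr; applyUpTo)
open import Data.Nat.Base as ℕ using (ℕ; zero; suc; _⊔_)
import Data.Nat.Properties as ℕ
open import Data.Nat.DivMod using (_mod_)
open import Data.Product.Base using (∃; _×_; _,_; proj₁; proj₂)
open import Data.Rational.Base as ℚ using (ℚ; 0ℚ; 1ℚ; ½)
import Data.Rational.Properties as ℚ
open import Data.Rational.Solver using (module +-*-Solver)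
open import Data.Sum.Base using (_⊎_)
open import Data.Vec.Base using ([]; _∷_)
open import Level using (0ℓ)
open import Relation.Binary.Core using (Rel)
import Relation.Binary.Definitions as B
open import Relation.Binary.PropositionalEquality
  using (_≡_; _≢_; refl; sym; trans; cong; subst; subst₂; ≢-sym)
open import Relation.Nullary.Decidable using (Dec; yes; no; ¬?; _×-dec_; _→-dec_; map′)
open import Relation.Nullary.Negation using (¬_)
open import Relation.Unary using (Pred; Decidable)

-- Elements of Fin n outside Vertex are not part of the graph.
record Graph (n : ℕ) : Set₁ where
  field
    Vertex     : Pred (Fin n) 0ℓ
    vertex?    : Decidable Vertex
    Adj        : Rel (Fin n) 0ℓ
    adj?       : B.Decidable Adj
    adj-vertex : ∀ {a b} → Adj a b → Vertex a
    adj-sym    : B.Symmetric Adj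
    adj-irrefl : ∀ {a} → ¬ Adj a a

module _ {n : ℕ} (G : Graph n) where
  open Graph G

  Independent : Pred (Subset n) 0ℓ
  Independent S =
    (∀ a → a ∈ S → Vertex a) ×
    (∀ a b → a ∈ S → b ∈ S → ¬ Adj a b)

  independent? : Decidable Independent
  independent? S =
    all? (λ a → (a ∈? S) →-dec vertex? a) ×-dec
    all? (λ a → all? (λ b → (a ∈? S) →-dec ((b ∈? S) →-dec ¬? (adj? a b))))

subsets : ∀ n → List (Subset n)
subsets zero    = [] ∷ []
subsets (suc n) = map (outside ∷_) (subsets n) ++ map (inside ∷_) (subsets n)

independentSets : ∀ {n} → Graph n → List (Subset n)
independentSets {n} G = filter (independent? G) (subsets n)

α : ∀ {n} → Graph n → ℕ
α G = foldr _⊔_ 0 (map ∣_∣ (independentSets G))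

s : ∀ {n} → ℕ → Graph n → ℕ
s k G = length (filter (λ S → ∣ S ∣ ℕ.≟ k) (independentSets G))

-- A polynomial is its list of coefficients, constant term first.
Polynomial : Set
Polynomial = List ℕ

I : ∀ {n} → Graph n → Polynomial
I G = applyUpTo (λ k → s k G) (suc (α G))

-- The ring ℤ/n is carried by its residues Fin n.
infixl 7 _*ₙ_

_*ₙ_ : ∀ {n} → Fin n → Fin n → Fin n
_*ₙ_ {n} a b = _mod_ (toℕ a ℕ.* toℕ b) n {{nonZeroIndex a}}

-- Stated via toℕ because Fin n has an element only when n is positive.
IsZeroₙ : ∀ {n} → Fin n → Set
IsZeroₙ a = toℕ a ≡ 0

isZeroₙ? : ∀ {n} (a : Fin n) → Dec (IsZeroₙ a)
isZeroₙ? a = toℕ a ℕ.≟ 0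

NonZeroZeroDivisor : ∀ {n} → Fin n → Set
NonZeroZeroDivisor a = ¬ IsZeroₙ a × ∃ λ b → ¬ IsZeroₙ b × IsZeroₙ (a *ₙ b)

nonZeroZeroDivisor? : ∀ {n} (a : Fin n) → Dec (NonZeroZeroDivisor a)
nonZeroZeroDivisor? a =
  ¬? (isZeroₙ? a) ×-dec any? (λ b → ¬? (isZeroₙ? b) ×-dec isZeroₙ? (a *ₙ b))

*ₙ-comm : ∀ {n} (a b : Fin n) → a *ₙ b ≡ b *ₙ a
*ₙ-comm {suc n} a b = cong (_mod suc n) (ℕ.*-comm (toℕ a) (toℕ b))

Γ : ∀ n → Graph n
Γ n = record
  { Vertex     = NonZeroZeroDivisor
  ; vertex?    = nonZeroZeroDivisor?
  ; Adj        = λ a b → NonZeroZeroDivisor a × NonZeroZeroDivisor b × a ≢ b × IsZeroₙ (a *ₙ b)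
  ; adj?       = λ a b → nonZeroZeroDivisor? a ×-dec nonZeroZeroDivisor? b
                           ×-dec ¬? (a ≟ᶠ b) ×-dec isZeroₙ? (a *ₙ b)
  ; adj-vertex = proj₁
  ; adj-sym    = λ { {a} {b} (va , vb , a≢b , ab≡0) →
                     vb , va , ≢-sym a≢b , subst IsZeroₙ (*ₙ-comm a b) ab≡0 }
  ; adj-irrefl = λ { (_ , _ , a≢a , _) → a≢a refl }
  }

-- Reals are Cauchy sequences of rationals, identified (_≈_) when their
-- difference tends to 0.

IsCauchy : (ℕ → ℚ) → Set
IsCauchy u = ∀ ε → 0ℚ ℚ.< ε →
  ∃ λ N → ∀ m n → N ℕ.≤ m → N ℕ.≤ n → ℚ.∣ u m ℚ.- u n ∣ ℚ.< ε

record ℝ : Set where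
  constructor mkℝ
  field
    seq    : ℕ → ℚ
    cauchy : IsCauchy seq

open ℝ public

infix 4 _≈_ _<_

_≈_ : ℝ → ℝ → Set
x ≈ y = ∀ ε → 0ℚ ℚ.< ε → ∃ λ N → ∀ n → N ℕ.≤ n → ℚ.∣ seq x n ℚ.- seq y n ∣ ℚ.< ε

-- The gap ε is uniform in n; termwise < alone would not survive the limit.
_<_ : ℝ → ℝ → Set
x < y = ∃ λ ε → 0ℚ ℚ.< ε × ∃ λ N → ∀ n → N ℕ.≤ n → seq x n ℚ.+ ε ℚ.< seq y n

fromℚ : ℚ → ℝ
fromℚ r = mkℝ (λ _ → r) λ ε 0<ε → 0 , λ _ _ _ _ →
  subst (λ t → ℚ.∣ t ∣ ℚ.< ε) (sym (ℚ.+-inverseʳ r)) 0<ε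

fromℤ : ℤ → ℝ
fromℤ i = fromℚ (i ℚ./ 1)

private
  halves : ∀ ε → ½ ℚ.* ε ℚ.+ ½ ℚ.* ε ≡ ε
  halves ε = trans (sym (ℚ.*-distribʳ-+ ε ½ ½)) (ℚ.*-identityˡ ε)

  half-pos : ∀ {ε} → 0ℚ ℚ.< ε → 0ℚ ℚ.< ½ ℚ.* ε
  half-pos {ε} 0<ε = subst (ℚ._< ½ ℚ.* ε) (ℚ.*-zeroʳ ½) (ℚ.*-monoʳ-<-pos ½ 0<ε)

  sum-diff : ∀ a b c d → (a ℚ.- c) ℚ.+ (b ℚ.- d) ≡ (a ℚ.+ b) ℚ.- (c ℚ.+ d)
  sum-diff = solve 4 (λ a b c d →
      (a :- c) :+ (b :- d) := (a :+ b) :- (c :+ d)) refl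
    where open +-*-Solver

  prod-diff : ∀ a b c d → a ℚ.* (b ℚ.- d) ℚ.+ d ℚ.* (a ℚ.- c) ≡ a ℚ.* b ℚ.- c ℚ.* d
  prod-diff = solve 4 (λ a b c d →
      a :* (b :- d) :+ d :* (a :- c) := a :* b :- c :* d) refl
    where open +-*-Solver

  cancel : ∀ a b → (a ℚ.- b) ℚ.+ b ≡ a
  cancel = solve 2 (λ a b → (a :- b) :+ b := a) refl
    where open +-*-Solver

  ≤-⊔₁ : ∀ {m} M N → M ℕ.⊔ N ℕ.≤ m → M ℕ.≤ m
  ≤-⊔₁ M N = ℕ.≤-trans (ℕ.m≤m⊔n M N)

  ≤-⊔₂ : ∀ {m} M N → M ℕ.⊔ N ℕ.≤ m → N ℕ.≤ m
  ≤-⊔₂ M N = ℕ.≤-trans (ℕ.m≤n⊔m M N)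

  sum-bound : ∀ {ε} s t → ℚ.∣ s ∣ ℚ.< ½ ℚ.* ε → ℚ.∣ t ∣ ℚ.< ½ ℚ.* ε → ℚ.∣ s ℚ.+ t ∣ ℚ.< ε
  sum-bound {ε} s t s< t< = ℚ.≤-<-trans (ℚ.∣p+q∣≤∣p∣+∣q∣ s t)
    (subst (ℚ.∣ s ∣ ℚ.+ ℚ.∣ t ∣ ℚ.<_) (halves ε) (ℚ.+-mono-< s< t<))

  bounded : ∀ {u} → IsCauchy u → ∃ λ B → 0ℚ ℚ.< B × ∃ λ N → ∀ n → N ℕ.≤ n → ℚ.∣ u n ∣ ℚ.≤ B
  bounded {u} cu with cu 1ℚ (ℚ.positive⁻¹ 1ℚ)
  ... | N , h = 1ℚ ℚ.+ ℚ.∣ u N ∣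
    , ℚ.+-mono-<-≤ (ℚ.positive⁻¹ 1ℚ) (ℚ.0≤∣p∣ (u N))
    , N
    , λ n N≤n → subst (λ t → ℚ.∣ t ∣ ℚ.≤ 1ℚ ℚ.+ ℚ.∣ u N ∣) (cancel (u n) (u N))
        (ℚ.≤-trans (ℚ.∣p+q∣≤∣p∣+∣q∣ (u n ℚ.- u N) (u N))
                   (ℚ.+-monoˡ-≤ ℚ.∣ u N ∣ (ℚ.<⇒≤ (h n N N≤n ℕ.≤-refl))))

  module Scale (B : ℚ) (0<B : 0ℚ ℚ.< B) where
    instance
      B-pos : ℚ.Positive B
      B-pos = ℚ.positive 0<B

      B-nonZero : ℚ.NonZero B
      B-nonZero = ℚ.pos⇒nonZero B

      1/B-pos : ℚ.Positive (ℚ.1/ B)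
      1/B-pos = ℚ.1/pos⇒pos B

    shrink : ℚ → ℚ
    shrink δ = ℚ.1/ B ℚ.* δ

    shrink-pos : ∀ {δ} → 0ℚ ℚ.< δ → 0ℚ ℚ.< shrink δ
    shrink-pos {δ} 0<δ =
      subst (ℚ._< shrink δ) (ℚ.*-zeroʳ (ℚ.1/ B)) (ℚ.*-monoʳ-<-pos (ℚ.1/ B) 0<δ)

    unshrink : ∀ δ → B ℚ.* shrink δ ≡ δ
    unshrink δ = trans (sym (ℚ.*-assoc B (ℚ.1/ B) δ))
      (trans (cong (ℚ._* δ) (ℚ.*-inverseʳ B)) (ℚ.*-identityˡ δ))

    scale-bound : ∀ {δ} c t → ℚ.∣ c ∣ ℚ.≤ B → ℚ.∣ t ∣ ℚ.< shrink δ → ℚ.∣ c ℚ.* t ∣ ℚ.< δ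
    scale-bound {δ} c t c≤ t< = subst₂ ℚ._<_ (sym (ℚ.∣p*q∣≡∣p∣*∣q∣ c t)) (unshrink δ)
      (ℚ.≤-<-trans
        (ℚ.*-monoʳ-≤-nonNeg ℚ.∣ t ∣ {{ℚ.∣-∣-nonNeg t}} c≤)
        (ℚ.*-monoʳ-<-pos B t<))

infixl 6 _+_
infixl 7 _*_

_+_ : ℝ → ℝ → ℝ
mkℝ u cu + mkℝ v cv = mkℝ (λ n → u n ℚ.+ v n) λ ε 0<ε →
  let M , hu = cu (½ ℚ.* ε) (half-pos 0<ε)
      N , hv = cv (½ ℚ.* ε) (half-pos 0<ε)
  in M ℕ.⊔ N , λ m n ≤m ≤n →
    subst (λ t → ℚ.∣ t ∣ ℚ.< ε) (sum-diff (u m) (v m) (u n) (v n))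
      (sum-bound (u m ℚ.- u n) (v m ℚ.- v n)
        (hu m n (≤-⊔₁ M N ≤m) (≤-⊔₁ M N ≤n))
        (hv m n (≤-⊔₂ M N ≤m) (≤-⊔₂ M N ≤n)))

_*_ : ℝ → ℝ → ℝ
mkℝ u cu * mkℝ v cv = mkℝ (λ n → u n ℚ.* v n) λ ε 0<ε →
  let A , 0<A , K , hA = bounded cu
      B , 0<B , L , hB = bounded cv
      M , hu = cu (Scale.shrink B 0<B (½ ℚ.* ε)) (Scale.shrink-pos B 0<B (half-pos 0<ε))
      N , hv = cv (Scale.shrink A 0<A (½ ℚ.* ε)) (Scale.shrink-pos A 0<A (half-pos 0<ε))
  in (K ℕ.⊔ L) ℕ.⊔ (M ℕ.⊔ N) , λ m n ≤m ≤n →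
    let KL≤m = ≤-⊔₁ (K ℕ.⊔ L) (M ℕ.⊔ N) ≤m ; MN≤m = ≤-⊔₂ (K ℕ.⊔ L) (M ℕ.⊔ N) ≤m
        KL≤n = ≤-⊔₁ (K ℕ.⊔ L) (M ℕ.⊔ N) ≤n ; MN≤n = ≤-⊔₂ (K ℕ.⊔ L) (M ℕ.⊔ N) ≤n
    in subst (λ t → ℚ.∣ t ∣ ℚ.< ε) (prod-diff (u m) (v m) (u n) (v n))
      (sum-bound (u m ℚ.* (v m ℚ.- v n)) (v n ℚ.* (u m ℚ.- u n))
        (Scale.scale-bound A 0<A (u m) (v m ℚ.- v n) (hA m (≤-⊔₁ K L KL≤m))
          (hv m n (≤-⊔₂ M N MN≤m) (≤-⊔₂ M N MN≤n)))
        (Scale.scale-bound B 0<B (v n) (u m ℚ.- u n) (hB n (≤-⊔₂ K L KL≤n))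
          (hu m n (≤-⊔₁ M N MN≤m) (≤-⊔₁ M N MN≤n))))

eval : Polynomial → ℝ → ℝ
eval []       x = fromℤ (+ 0)
eval (c ∷ cs) x = fromℤ (+ c) + x * eval cs x

IsZero : Polynomial → ℝ → Set
IsZero P x = eval P x ≈ fromℤ (+ 0)

InInterval : ℤ → ℤ → ℝ → Set
InInterval a b x = fromℤ a < x × x < fromℤ b

-- Zeros are counted without multiplicity.
ExactlyTwoZeros : Polynomial → ℝ → ℝ → Set
ExactlyTwoZeros P x y =
  IsZero P x × IsZero P y × ¬ (x ≈ y) × (∀ z → IsZero P z → z ≈ x ⊎ z ≈ y)

{-# OPTIONS --safe #-}

-- Γ(ℤ_pq) is complete bipartite, with parts the non-zero multiples of q (p - 1 of them) and of p
-- (q - 1 of them), so the independent sets are the subsets of either part and, in the variable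
-- y = 1 + x, the independence polynomial is y^(p-1) + y^(q-1) - 1.  It has a single zero in y > 0,
-- which lies in (1/2, 1).  For p odd both exponents are even, so the negative zero is the mirror
-- image of the positive one; for p = 2 put y = - t, which gives t^(q-1) - t - 1 with a single zero
-- t > 0, lying in (1, 2).  Each zero is a bisection sequence.  Near a zero the function expands
-- distances, so any two sequences of approximate zeros approach each other: this makes the
-- bisection sequence Cauchy and the zero unique.

module Submission where

open import Defs
open import Data.Integer.Base using (+_; -_)
open import Data.Nat.Base using (ℕ) renaming (_<_ to _<ℕ_; _*_ to _*ℕ_)
open import Data.Nat.Divisibility using (_∣_)
open import Data.Nat.Primality using (Prime)
open import Data.Product.Base using (∃₂; _×_)
open import Relation.Binary.PropositionalEquality using (_≡_)
open import Relation.Nullary.Negation using (¬_)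

open import Algebra.Bundles using (CommutativeRing)
open import Data.Bool.Base using (Bool; if_then_else_; true; false)
open import Data.Fin.Base using (Fin; zero; suc; toℕ; fromℕ<)
open import Data.Fin.Properties using (toℕ<n; toℕ-fromℕ<; any?)
open import Data.Fin.Subset using (Subset; inside; outside; _⊆_; _∈_) renaming (⊥ to ∅; ∣_∣ to card)
open import Data.Fin.Subset.Properties using (_⊆?_; _∈?_; drop-∷-⊆; out⊆; in⊆in; ∣⊥∣≡0; ∉⊥)
open import Data.Integer.Base as ℤ using (ℤ; +<+)
import Data.Integer.Properties as ℤ
open import Data.List.Base using (List; []; _∷_; _++_; map; filter; length; foldr; applyUpTo)
open import Data.Nat.Base as ℕ using (zero; suc; _⊔_; z<s; s<s; s≤s; NonZero; ≢-nonZero)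
open import Data.Nat.Divisibility as ℕ
  using (_∣?_; divides; divides-refl; n∣m*n; m∣m*n; ∣-trans; *-pres-∣; >⇒∤; m%n≡0⇒n∣m; n∣m⇒m%n≡0; ∣m+n∣m⇒∣n; ∣m∣n⇒∣m+n)
open import Data.Nat.DivMod using (_mod_; _%_; m%n<n)
open import Data.Nat.Primality using (euclidsLemma; prime⇒nonZero; prime⇒nonTrivial; prime⇒irreducible)
import Data.Nat.Properties as ℕ
open import Data.Product.Base using (_,_; proj₁; proj₂; ∃; map₂)
open import Data.Rational.Base as ℚ using (ℚ; mkℚ; 0ℚ; 1ℚ; ½; toℚᵘ)
import Data.Rational.Properties as ℚ
open import Data.Rational.Solver using (module +-*-Solver)
open import Data.Rational.Unnormalised.Base as ℚᵘ using (mkℚᵘ)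
import Data.Rational.Unnormalised.Properties as ℚᵘ
open import Data.Sum.Base using (_⊎_; inj₁; inj₂; [_,_]′)
open import Data.Vec.Base using ([]; _∷_; tabulate; here)
open import Data.Vec.Properties using (lookup∘tabulate; lookup⇒[]=; []=⇒lookup)
open import Function.Base using (_∘_)
open import Function.Bundles using (mk⇔)
open import Relation.Binary.PropositionalEquality
  using (_≢_; _≗_; refl; sym; trans; cong; cong₂; subst; subst₂; module ≡-Reasoning)
open import Relation.Nullary.Decidable
  using (Dec; does; yes; no; ¬?; _×-dec_; dec-true; dec-false; does-⇔; from-yes)
open import Relation.Nullary.Negation using (contradiction)
open import Relation.Unary using (Decidable)

open import Algebra.Properties.Semiring.Exp (CommutativeRing.semiring ℚ.+-*-commutativeRing) using (_^_)
open +-*-Solver using (solve; _:=_; _:+_; _:*_; _:-_; :-_; con)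

-- The independence polynomial as a sum over vertex subsets

private
  variable
    X Y : Set

evalℚ : Polynomial → ℚ → ℚ
evalℚ []       r = 0ℚ
evalℚ (c ∷ cs) r = + c ℚ./ 1 ℚ.+ r ℚ.* evalℚ cs r

-- Real sums and products act termwise on the approximating sequences. This reduces every question
-- about zeros of `P` to rational evaluations.
seq-eval : ∀ P x n → seq (eval P x) n ≡ evalℚ P (seq x n)
seq-eval []       x n = refl
seq-eval (c ∷ cs) x n = cong (λ t → + c ℚ./ 1 ℚ.+ seq x n ℚ.* t) (seq-eval cs x n)

/1-homo-+ : ∀ m n → + (m ℕ.+ n) ℚ./ 1 ≡ + m ℚ./ 1 ℚ.+ + n ℚ./ 1
/1-homo-+ m n = ℚ.toℚᵘ-injective (begin
  toℚᵘ (+ (m ℕ.+ n) ℚ./ 1)                  ≈⟨ ℚ.toℚᵘ-fromℚᵘ (mkℚᵘ (+ (m ℕ.+ n)) 0) ⟩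
  mkℚᵘ (+ (m ℕ.+ n)) 0                      ≈⟨ ℚᵘ.*≡* (cong (ℤ._* + 1) (sym (cong₂ ℤ._+_ (ℤ.*-identityʳ (+ m)) (ℤ.*-identityʳ (+ n))))) ⟩
  mkℚᵘ (+ m) 0 ℚᵘ.+ mkℚᵘ (+ n) 0            ≈⟨ ℚᵘ.+-cong (ℚ.toℚᵘ-fromℚᵘ (mkℚᵘ (+ m) 0)) (ℚ.toℚᵘ-fromℚᵘ (mkℚᵘ (+ n) 0)) ⟨
  toℚᵘ (+ m ℚ./ 1) ℚᵘ.+ toℚᵘ (+ n ℚ./ 1)    ≈⟨ ℚ.toℚᵘ-homo-+ (+ m ℚ./ 1) (+ n ℚ./ 1) ⟨
  toℚᵘ (+ m ℚ./ 1 ℚ.+ + n ℚ./ 1)            ∎)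
  where open ℚᵘ.≃-Reasoning

∑ : (X → ℚ) → List X → ℚ
∑ f []       = 0ℚ
∑ f (x ∷ xs) = f x ℚ.+ ∑ f xs

syntax ∑ (λ x → e) xs = ∑[ x ← xs ] e

∑-cong : ∀ {f g : X → ℚ} → f ≗ g → ∑ f ≗ ∑ g
∑-cong f≗g []       = refl
∑-cong f≗g (x ∷ xs) = cong₂ ℚ._+_ (f≗g x) (∑-cong f≗g xs)

∑-zero : ∀ {f : X → ℚ} → (∀ x → f x ≡ 0ℚ) → ∀ xs → ∑ f xs ≡ 0ℚ
∑-zero f≡0 []       = refl
∑-zero f≡0 (x ∷ xs) = cong₂ ℚ._+_ (f≡0 x) (∑-zero f≡0 xs)

interchange : ∀ a b c d → (a ℚ.+ b) ℚ.+ (c ℚ.+ d) ≡ (a ℚ.+ c) ℚ.+ (b ℚ.+ d)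
interchange = solve 4 (λ a b c d → (a :+ b) :+ (c :+ d) := (a :+ c) :+ (b :+ d)) refl

∑-+ : ∀ (f g : X → ℚ) xs → ∑[ x ← xs ] (f x ℚ.+ g x) ≡ ∑ f xs ℚ.+ ∑ g xs
∑-+ f g []       = refl
∑-+ f g (x ∷ xs) = trans (cong (f x ℚ.+ g x ℚ.+_) (∑-+ f g xs)) (interchange (f x) (g x) (∑ f xs) (∑ g xs))

∑-*ˡ : ∀ c (f : X → ℚ) xs → ∑[ x ← xs ] (c ℚ.* f x) ≡ c ℚ.* ∑ f xs
∑-*ˡ c f []       = sym (ℚ.*-zeroʳ c)
∑-*ˡ c f (x ∷ xs) = trans (cong (c ℚ.* f x ℚ.+_) (∑-*ˡ c f xs)) (sym (ℚ.*-distribˡ-+ c (f x) (∑ f xs)))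

∑-++ : ∀ (f : X → ℚ) xs ys → ∑ f (xs ++ ys) ≡ ∑ f xs ℚ.+ ∑ f ys
∑-++ f []       ys = sym (ℚ.+-identityˡ (∑ f ys))
∑-++ f (x ∷ xs) ys = trans (cong (f x ℚ.+_) (∑-++ f xs ys)) (sym (ℚ.+-assoc (f x) (∑ f xs) (∑ f ys)))

∑-map : ∀ (f : Y → ℚ) (h : X → Y) xs → ∑ f (map h xs) ≡ ∑ (f ∘ h) xs
∑-map f h []       = refl
∑-map f h (x ∷ xs) = cong (f (h x) ℚ.+_) (∑-map f h xs)

⟦_⟧ : {P : Set} → Dec P → ℚ
⟦ p? ⟧ = if does p? then 1ℚ else 0ℚ

⟦yes⟧ : ∀ {P : Set} (p? : Dec P) → P → ⟦ p? ⟧ ≡ 1ℚ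
⟦yes⟧ (yes _) _ = refl
⟦yes⟧ (no ¬p) p = contradiction p ¬p

⟦no⟧ : ∀ {P : Set} (p? : Dec P) → ¬ P → ⟦ p? ⟧ ≡ 0ℚ
⟦no⟧ (yes p) ¬p = contradiction p ¬p
⟦no⟧ (no _)  _  = refl

∑-filter : ∀ {P : X → Set} (P? : Decidable P) f xs →
  ∑ f (filter P? xs) ≡ ∑[ x ← xs ] (⟦ P? x ⟧ ℚ.* f x)
∑-filter P? f []       = refl
∑-filter P? f (x ∷ xs) with does (P? x)
... | true  = cong₂ ℚ._+_ (sym (ℚ.*-identityˡ (f x))) (∑-filter P? f xs)
... | false = trans (∑-filter P? f xs)
  (trans (sym (ℚ.+-identityˡ _)) (cong (ℚ._+ _) (sym (ℚ.*-zeroˡ (f x)))))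

evalℚ-cong : ∀ {f g : ℕ → ℕ} → f ≗ g → ∀ n r → evalℚ (applyUpTo f n) r ≡ evalℚ (applyUpTo g n) r
evalℚ-cong f≗g zero    r = refl
evalℚ-cong f≗g (suc n) r =
  cong₂ (λ c t → + c ℚ./ 1 ℚ.+ r ℚ.* t) (f≗g 0) (evalℚ-cong (f≗g ∘ suc) n r)

evalℚ-0 : ∀ n r → evalℚ (applyUpTo (λ _ → 0) n) r ≡ 0ℚ
evalℚ-0 zero    r = refl
evalℚ-0 (suc n) r = trans (ℚ.+-identityˡ _) (trans (cong (r ℚ.*_) (evalℚ-0 n r)) (ℚ.*-zeroʳ r))

evalℚ-+ : ∀ f g n r → evalℚ (applyUpTo (λ k → f k ℕ.+ g k) n) r
  ≡ evalℚ (applyUpTo f n) r ℚ.+ evalℚ (applyUpTo g n) r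
evalℚ-+ f g zero    r = refl
evalℚ-+ f g (suc n) r = begin
  + (f 0 ℕ.+ g 0) ℚ./ 1 ℚ.+ r ℚ.* evalℚ (applyUpTo (λ k → f (suc k) ℕ.+ g (suc k)) n) r
    ≡⟨ cong₂ (λ c t → c ℚ.+ r ℚ.* t) (/1-homo-+ (f 0) (g 0)) (evalℚ-+ (f ∘ suc) (g ∘ suc) n r) ⟩
  (a ℚ.+ b) ℚ.+ r ℚ.* (s' ℚ.+ t)
    ≡⟨ cong (a ℚ.+ b ℚ.+_) (ℚ.*-distribˡ-+ r s' t) ⟩
  (a ℚ.+ b) ℚ.+ (r ℚ.* s' ℚ.+ r ℚ.* t)
    ≡⟨ interchange a b (r ℚ.* s') (r ℚ.* t) ⟩
  (a ℚ.+ r ℚ.* s') ℚ.+ (b ℚ.+ r ℚ.* t) ∎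
  where
  open ≡-Reasoning
  a = + f 0 ℚ./ 1
  b = + g 0 ℚ./ 1
  s' = evalℚ (applyUpTo (f ∘ suc) n) r
  t = evalℚ (applyUpTo (g ∘ suc) n) r

-- As a function of `k`, the coefficient sequence of the monomial of degree `m`.
δ : ℕ → ℕ → ℕ
δ m k = if does (m ℕ.≟ k) then 1 else 0

evalℚ-δ : ∀ {m n} → m ℕ.< n → ∀ r → evalℚ (applyUpTo (δ m) n) r ≡ r ^ m
evalℚ-δ {zero}  {suc n} z<s       r = trans (cong (λ t → 1ℚ ℚ.+ r ℚ.* t) (evalℚ-0 n r)) (cong (1ℚ ℚ.+_) (ℚ.*-zeroʳ r))
evalℚ-δ {suc m} {suc n} (s<s m<n) r = trans (ℚ.+-identityˡ _) (cong (r ℚ.*_) (evalℚ-δ m<n r))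

length-filter-∷ : ∀ {P : X → Set} (P? : Decidable P) x xs →
  length (filter P? (x ∷ xs)) ≡ (if does (P? x) then 1 else 0) ℕ.+ length (filter P? xs)
length-filter-∷ P? x xs with does (P? x)
... | true  = refl
... | false = refl

-- Each list element contributes the monomial `δ (w x)` to the coefficients. The bound on the
-- maximal weight ensures that the cut-off at `n` loses no monomial; for `I G` the cut-off
-- `suc (α G)` is just large enough.
evalℚ-tally : ∀ (w : X → ℕ) xs {n} → foldr _⊔_ 0 (map w xs) ℕ.< n → ∀ r →
  evalℚ (applyUpTo (λ k → length (filter (λ x → w x ℕ.≟ k) xs)) n) r ≡ ∑[ x ← xs ] (r ^ w x)
evalℚ-tally w []       {n} _   r = evalℚ-0 n r
evalℚ-tally w (x ∷ xs) {n} <n r = begin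
  evalℚ (applyUpTo (λ k → length (filter (λ y → w y ℕ.≟ k) (x ∷ xs))) n) r
    ≡⟨ evalℚ-cong (λ k → length-filter-∷ (λ y → w y ℕ.≟ k) x xs) n r ⟩
  evalℚ (applyUpTo (λ k → δ (w x) k ℕ.+ tally k) n) r
    ≡⟨ evalℚ-+ (δ (w x)) tally n r ⟩
  evalℚ (applyUpTo (δ (w x)) n) r ℚ.+ evalℚ (applyUpTo tally n) r
    ≡⟨ cong₂ ℚ._+_ (evalℚ-δ (ℕ.m⊔n<o⇒m<o (w x) _ <n) r) (evalℚ-tally w xs (ℕ.m⊔n<o⇒n<o (w x) _ <n) r) ⟩
  r ^ w x ℚ.+ ∑[ y ← xs ] (r ^ w y) ∎
  where
  open ≡-Reasoning
  tally : ℕ → ℕ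
  tally k = length (filter (λ y → w y ℕ.≟ k) xs)

evalℚ-I : ∀ {n} (G : Graph n) r →
  evalℚ (I G) r ≡ ∑[ S ← subsets n ] (⟦ independent? G S ⟧ ℚ.* r ^ card S)
evalℚ-I G r = trans (evalℚ-tally card (independentSets G) (ℕ.n<1+n (α G)) r)
                    (∑-filter (independent? G) (λ S → r ^ card S) (subsets _))

⟦⟧-cong : ∀ {P Q : Set} (p? : Dec P) (q? : Dec Q) → (P → Q) → (Q → P) → ⟦ p? ⟧ ≡ ⟦ q? ⟧
⟦⟧-cong (yes p) q? f g = sym (⟦yes⟧ q? (f p))
⟦⟧-cong (no ¬p) q? f g = sym (⟦no⟧ q? (¬p ∘ g))

-- The binomial theorem by induction on `A`. Subsets avoiding the head reproduce the sum of the
-- tail; subsets containing it contribute `r` times that sum if the head lies in `A`, and nothing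
-- otherwise. Each element of `A` thus yields a factor `1 + r`.
∑-subsets-⊆ : ∀ {n} (A : Subset n) r →
  ∑[ S ← subsets n ] (⟦ S ⊆? A ⟧ ℚ.* r ^ card S) ≡ (1ℚ ℚ.+ r) ^ card A
∑-subsets-⊆ []      r = refl
∑-subsets-⊆ {suc n} (x ∷ A) r = trans
  (trans (∑-++ term (map (outside ∷_) (subsets n)) (map (inside ∷_) (subsets n)))
    (cong₂ ℚ._+_
      (trans (∑-map term (outside ∷_) (subsets n))
        (trans (∑-cong (λ S → cong (ℚ._* r ^ card S) (⟦⟧-cong ((outside ∷ S) ⊆? (x ∷ A)) (S ⊆? A) drop-∷-⊆ out⊆)) (subsets n))
          (∑-subsets-⊆ A r)))
      (∑-map term (inside ∷_) (subsets n))))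
  (with-head x)
  where
  term : Subset (suc n) → ℚ
  term S = ⟦ S ⊆? (x ∷ A) ⟧ ℚ.* r ^ card S

  pull : ∀ a b c → a ℚ.* (b ℚ.* c) ≡ b ℚ.* (a ℚ.* c)
  pull = solve 3 (λ a b c → a :* (b :* c) := b :* (a :* c)) refl

  with-head : ∀ x → (1ℚ ℚ.+ r) ^ card A ℚ.+ ∑[ S ← subsets n ] (⟦ (inside ∷ S) ⊆? (x ∷ A) ⟧ ℚ.* r ^ card (inside ∷ S))
    ≡ (1ℚ ℚ.+ r) ^ card (x ∷ A)
  with-head outside = trans
    (cong ((1ℚ ℚ.+ r) ^ card A ℚ.+_) (∑-zero (λ S → trans
      (cong (ℚ._* r ^ card (inside ∷ S)) (⟦no⟧ ((inside ∷ S) ⊆? (outside ∷ A)) (λ S⊆A → 0∉outside∷A (S⊆A here))))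
      (ℚ.*-zeroˡ (r ^ card (inside ∷ S)))) (subsets n)))
    (ℚ.+-identityʳ _)
    where
    0∉outside∷A : ¬ (zero ∈ outside ∷ A)
    0∉outside∷A ()
  with-head inside = begin
    (1ℚ ℚ.+ r) ^ card A ℚ.+ ∑[ S ← subsets n ] (⟦ (inside ∷ S) ⊆? (inside ∷ A) ⟧ ℚ.* (r ℚ.* r ^ card S))
      ≡⟨ cong ((1ℚ ℚ.+ r) ^ card A ℚ.+_) (∑-cong (λ S → trans
          (cong (ℚ._* (r ℚ.* r ^ card S)) (⟦⟧-cong ((inside ∷ S) ⊆? (inside ∷ A)) (S ⊆? A) drop-∷-⊆ in⊆in))
          (pull ⟦ S ⊆? A ⟧ r (r ^ card S))) (subsets n)) ⟩
    (1ℚ ℚ.+ r) ^ card A ℚ.+ ∑[ S ← subsets n ] (r ℚ.* (⟦ S ⊆? A ⟧ ℚ.* r ^ card S))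
      ≡⟨ cong ((1ℚ ℚ.+ r) ^ card A ℚ.+_) (trans (∑-*ˡ r (λ S → ⟦ S ⊆? A ⟧ ℚ.* r ^ card S) (subsets n)) (cong (r ℚ.*_) (∑-subsets-⊆ A r))) ⟩
    (1ℚ ℚ.+ r) ^ card A ℚ.+ r ℚ.* (1ℚ ℚ.+ r) ^ card A
      ≡⟨ solve 2 (λ r t → t :+ r :* t := (con 1ℚ :+ r) :* t) refl r ((1ℚ ℚ.+ r) ^ card A) ⟩
    (1ℚ ℚ.+ r) ℚ.* (1ℚ ℚ.+ r) ^ card A ∎
    where
    open ≡-Reasoning

module _ {n} (G : Graph n) {A B : Subset n} (disjoint : ∀ {v} → v ∈ A → ¬ (v ∈ B))
  (⊆⇒independent : ∀ {S} → S ⊆ A ⊎ S ⊆ B → Independent G S)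
  (independent⇒⊆ : ∀ {S} → Independent G S → S ⊆ A ⊎ S ⊆ B) where

  -- The empty set is the only subset of both parts.
  independent-count : ∀ S → ⟦ independent? G S ⟧ ℚ.+ ⟦ S ⊆? ∅ ⟧ ≡ ⟦ S ⊆? A ⟧ ℚ.+ ⟦ S ⊆? B ⟧
  independent-count S with S ⊆? A | S ⊆? B
  ... | yes S⊆A | yes S⊆B = cong₂ ℚ._+_ (⟦yes⟧ (independent? G S) (⊆⇒independent (inj₁ S⊆A)))
          (⟦yes⟧ (S ⊆? ∅) (λ v∈S → contradiction (S⊆B v∈S) (disjoint (S⊆A v∈S))))
  ... | yes S⊆A | no S⊈B = cong₂ ℚ._+_ (⟦yes⟧ (independent? G S) (⊆⇒independent (inj₁ S⊆A)))
          (⟦no⟧ (S ⊆? ∅) (λ S⊆∅ → S⊈B (λ v∈S → contradiction (S⊆∅ v∈S) ∉⊥)))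
  ... | no S⊈A | yes S⊆B = cong₂ ℚ._+_ (⟦yes⟧ (independent? G S) (⊆⇒independent (inj₂ S⊆B)))
          (⟦no⟧ (S ⊆? ∅) (λ S⊆∅ → S⊈A (λ v∈S → contradiction (S⊆∅ v∈S) ∉⊥)))
  ... | no S⊈A | no S⊈B = cong₂ ℚ._+_ (⟦no⟧ (independent? G S) ([ S⊈A , S⊈B ]′ ∘ independent⇒⊆))
          (⟦no⟧ (S ⊆? ∅) (λ S⊆∅ → S⊈A (λ v∈S → contradiction (S⊆∅ v∈S) ∉⊥)))

  -- Subsets of `A` and subsets of `B` together count each independent set once, except the empty
  -- set, which they count twice. The surplus is the subset sum of `∅`, namely 1.
  evalℚ-I-bipartite : ∀ r → evalℚ (I G) r ≡ (1ℚ ℚ.+ r) ^ card A ℚ.+ (1ℚ ℚ.+ r) ^ card B ℚ.- 1ℚ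
  evalℚ-I-bipartite r = begin
    evalℚ (I G) r                            ≡⟨ evalℚ-I G r ⟩
    ∑ ind (subsets n)                        ≡⟨ solve 1 (λ t → t := t :+ con 1ℚ :- con 1ℚ) refl (∑ ind (subsets n)) ⟩
    ∑ ind (subsets n) ℚ.+ 1ℚ ℚ.- 1ℚ          ≡⟨ cong (λ t → ∑ ind (subsets n) ℚ.+ t ℚ.- 1ℚ) ∑-∅ ⟨
    ∑ ind (subsets n) ℚ.+ ∑ (sub ∅) (subsets n) ℚ.- 1ℚ ≡⟨ cong (ℚ._- 1ℚ) (∑-+ ind (sub ∅) (subsets n)) ⟨
    ∑[ S ← subsets n ] (ind S ℚ.+ sub ∅ S) ℚ.- 1ℚ ≡⟨ cong (ℚ._- 1ℚ) (∑-cong pointwise (subsets n)) ⟩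
    ∑[ S ← subsets n ] (sub A S ℚ.+ sub B S) ℚ.- 1ℚ ≡⟨ cong (ℚ._- 1ℚ) (∑-+ (sub A) (sub B) (subsets n)) ⟩
    ∑ (sub A) (subsets n) ℚ.+ ∑ (sub B) (subsets n) ℚ.- 1ℚ
      ≡⟨ cong₂ (λ x y → x ℚ.+ y ℚ.- 1ℚ) (∑-subsets-⊆ A r) (∑-subsets-⊆ B r) ⟩
    (1ℚ ℚ.+ r) ^ card A ℚ.+ (1ℚ ℚ.+ r) ^ card B ℚ.- 1ℚ ∎
    where
    open ≡-Reasoning
    sub : Subset n → Subset n → ℚ
    sub C S = ⟦ S ⊆? C ⟧ ℚ.* r ^ card S

    ind : Subset n → ℚ
    ind S = ⟦ independent? G S ⟧ ℚ.* r ^ card S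

    ∑-∅ : ∑ (sub ∅) (subsets n) ≡ 1ℚ
    ∑-∅ = trans (∑-subsets-⊆ (∅ {n}) r) (cong ((1ℚ ℚ.+ r) ^_) (∣⊥∣≡0 n))

    pointwise : ∀ S → ind S ℚ.+ sub ∅ S ≡ sub A S ℚ.+ sub B S
    pointwise S = trans (sym (ℚ.*-distribʳ-+ (r ^ card S) ⟦ independent? G S ⟧ ⟦ S ⊆? ∅ ⟧))
      (trans (cong (ℚ._* r ^ card S) (independent-count S))
        (ℚ.*-distribʳ-+ (r ^ card S) ⟦ S ⊆? A ⟧ ⟦ S ⊆? B ⟧))

-- The zero divisor graph of ℤ/pq

count : (ℕ → Bool) → ℕ → ℕ
count f zero    = 0
count f (suc n) = (if f 0 then 1 else 0) ℕ.+ count (f ∘ suc) n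

-- Moves the counting from `Fin n` to initial segments of ℕ, which `count-+` can cut and translate.
card-tabulate : ∀ f n → card (tabulate {n = n} (f ∘ toℕ)) ≡ count f n
card-tabulate f zero = refl
card-tabulate f (suc n) with f 0
... | true  = cong suc (card-tabulate (f ∘ suc) n)
... | false = card-tabulate (f ∘ suc) n

count-cong : ∀ {f g} n → (∀ {k} → k ℕ.< n → f k ≡ g k) → count f n ≡ count g n
count-cong zero    f≗g = refl
count-cong (suc n) f≗g = cong₂ (λ b c → (if b then 1 else 0) ℕ.+ c) (f≗g z<s) (count-cong n (f≗g ∘ s<s))

count-false : ∀ n → count (λ _ → false) n ≡ 0
count-false zero    = refl
count-false (suc n) = count-false n

count-+ : ∀ f m n → count f (m ℕ.+ n) ≡ count f m ℕ.+ count (f ∘ (m ℕ.+_)) n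
count-+ f zero    n = refl
count-+ f (suc m) n = trans (cong (_ ℕ.+_) (count-+ (f ∘ suc) m n))
  (sym (ℕ.+-assoc (if f 0 then 1 else 0) (count (f ∘ suc) m) _))

-- Cut the range into `m` blocks of length `d`. Only the first element of a block is a multiple of
-- `d`, and translation by `d` preserves divisibility.
count-∣ : ∀ d m .{{_ : NonZero d}} → count (λ k → does (d ∣? k)) (m ℕ.* d) ≡ m
count-∣ d         zero    = refl
count-∣ d@(suc e) (suc m) = trans (count-+ (λ k → does (d ∣? k)) d (m ℕ.* d)) (cong₂ ℕ._+_ first-block other-blocks)
  where
  first-block : count (λ k → does (d ∣? k)) d ≡ 1
  first-block = cong₂ (λ b c → (if b then 1 else 0) ℕ.+ c) (dec-true (d ∣? 0) (divides-refl 0))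
    (trans (count-cong e (λ {k} k<e → dec-false (d ∣? suc k) (>⇒∤ (s<s k<e)))) (count-false e))

  other-blocks : count (λ k → does (d ∣? (d ℕ.+ k))) (m ℕ.* d) ≡ m
  other-blocks = trans
    (count-cong (m ℕ.* d) λ {k} _ →
      does-⇔ (mk⇔ (λ d∣d+k → ∣m+n∣m⇒∣n d∣d+k ℕ.∣-refl) (∣m∣n⇒∣m+n ℕ.∣-refl)) (d ∣? (d ℕ.+ k)) (d ∣? k))
    (count-∣ d m)

does-true⁻ : ∀ {P : Set} (p? : Dec P) → does p? ≡ true → P
does-true⁻ (yes p) _ = p

NonZeroMultiple : ℕ → ℕ → Set
NonZeroMultiple d k = k ≢ 0 × d ∣ k

nonZeroMultiple? : ∀ d → Decidable (NonZeroMultiple d)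
nonZeroMultiple? d k = ¬? (k ℕ.≟ 0) ×-dec (d ∣? k)

multiples : ∀ d n → Subset n
multiples d n = tabulate (λ i → does (nonZeroMultiple? d (toℕ i)))

∈-multiples⁺ : ∀ d {n} {i : Fin n} → NonZeroMultiple d (toℕ i) → i ∈ multiples d n
∈-multiples⁺ d {n} {i} m = lookup⇒[]= i (multiples d n)
  (trans (lookup∘tabulate _ i) (dec-true (nonZeroMultiple? d (toℕ i)) m))

∈-multiples⁻ : ∀ d {n} {i : Fin n} → i ∈ multiples d n → NonZeroMultiple d (toℕ i)
∈-multiples⁻ d {n} {i} i∈ = does-true⁻ (nonZeroMultiple? d (toℕ i))
  (trans (sym (lookup∘tabulate _ i)) ([]=⇒lookup i∈))

suc-card-multiples : ∀ d m n .{{_ : NonZero d}} .{{_ : NonZero n}} → n ≡ m ℕ.* d → suc (card (multiples d n)) ≡ m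
suc-card-multiples d m n@(suc n-1) n≡m*d = begin
  suc (card (multiples d n))                                 ≡⟨ cong suc (card-tabulate (λ k → does (nonZeroMultiple? d k)) n) ⟩
  suc (count (λ k → does (nonZeroMultiple? d (suc k))) n-1)
    ≡⟨ cong suc (count-cong n-1 λ {k} _ → does-⇔ (mk⇔ proj₂ ((λ ()) ,_)) (nonZeroMultiple? d (suc k)) (d ∣? suc k)) ⟩
  -- The extra `suc` is the residue 0, a multiple of `d` that `NonZeroMultiple` leaves out.
  suc (count (λ k → does (d ∣? suc k)) n-1)             ≡⟨ cong (λ b → (if b then 1 else 0) ℕ.+ count (λ k → does (d ∣? suc k)) n-1) (dec-true (d ∣? 0) (divides-refl 0)) ⟨
  count (λ k → does (d ∣? k)) n                         ≡⟨ cong (count (λ k → does (d ∣? k))) n≡m*d ⟩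
  count (λ k → does (d ∣? k)) (m ℕ.* d)                 ≡⟨ count-∣ d m ⟩
  m                                                     ∎
  where open ≡-Reasoning

toℕ-mod : ∀ m n .{{_ : NonZero n}} → toℕ (m mod n) ≡ m % n
toℕ-mod m n = toℕ-fromℕ< (m%n<n m n)

IsZeroₙ⇒∣ : ∀ {n} {a b : Fin n} → IsZeroₙ (a *ₙ b) → n ∣ toℕ a ℕ.* toℕ b
IsZeroₙ⇒∣ {n@(suc _)} {a} {b} ab≡0 = m%n≡0⇒n∣m _ n (trans (sym (toℕ-mod (toℕ a ℕ.* toℕ b) n)) ab≡0)

∣⇒IsZeroₙ : ∀ {n} {a b : Fin n} → n ∣ toℕ a ℕ.* toℕ b → IsZeroₙ (a *ₙ b)
∣⇒IsZeroₙ {n@(suc _)} {a} {b} n∣ab = trans (toℕ-mod (toℕ a ℕ.* toℕ b) n) (n∣m⇒m%n≡0 _ n n∣ab)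

prime>1 : ∀ {p} → Prime p → 1 ℕ.< p
prime>1 p-prime = ℕ.nonTrivial⇒n>1 _ {{prime⇒nonTrivial p-prime}}

module _ {p q : ℕ} (p-prime : Prime p) (q-prime : Prime q) (p<q : p ℕ.< q) where
  private
    n = p ℕ.* q

    instance
      p-nonZero : NonZero p
      p-nonZero = prime⇒nonZero p-prime

      q-nonZero : NonZero q
      q-nonZero = prime⇒nonZero q-prime

      n-nonZero : NonZero n
      n-nonZero = ℕ.m*n≢0 p q

    1<p : 1 ℕ.< p
    1<p = prime>1 p-prime

    1<q : 1 ℕ.< q
    1<q = ℕ.<-trans 1<p p<q

  p∤q : ¬ (p ∣ q)
  p∤q p∣q with prime⇒irreducible q-prime p∣q
  ... | inj₁ p≡1 = ℕ.<⇒≢ 1<p (sym p≡1)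
  ... | inj₂ p≡q = ℕ.<⇒≢ p<q p≡q

  -- Write `k` as `c * q`: Euclid's lemma sends `p` into `c`, because `p` does not divide `q`.
  p∣k∧q∣k⇒n∣k : ∀ {k} → p ∣ k → q ∣ k → n ∣ k
  p∣k∧q∣k⇒n∣k p∣k (divides c refl) with euclidsLemma c q p-prime p∣k
  ... | inj₁ p∣c = *-pres-∣ p∣c ℕ.∣-refl
  ... | inj₂ p∣q = contradiction p∣q p∤q

  -- Otherwise `n` would divide a non-zero number below `n`. This keeps the two parts disjoint and
  -- underlies all the adjacency arguments below.
  residue-∤ : ∀ (v : Fin n) → toℕ v ≢ 0 → p ∣ toℕ v → ¬ (q ∣ toℕ v)
  residue-∤ v v≢0 p∣v q∣v = >⇒∤ {{≢-nonZero v≢0}} (toℕ<n v) (p∣k∧q∣k⇒n∣k p∣v q∣v)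

  -- Both primes divide `v * w`. If neither divided `v`, both would divide the non-zero residue `w`.
  vertex⇒∣ : ∀ {v : Fin n} → NonZeroZeroDivisor v → p ∣ toℕ v ⊎ q ∣ toℕ v
  vertex⇒∣ {v} (v≢0 , w , w≢0 , vw≡0)
    with euclidsLemma (toℕ v) (toℕ w) p-prime (∣-trans (m∣m*n q) (IsZeroₙ⇒∣ {n} {v} {w} vw≡0))
       | euclidsLemma (toℕ v) (toℕ w) q-prime (∣-trans (n∣m*n p) (IsZeroₙ⇒∣ {n} {v} {w} vw≡0))
  ... | inj₁ p∣v | _        = inj₁ p∣v
  ... | inj₂ _   | inj₁ q∣v = inj₂ q∣v
  ... | inj₂ p∣w | inj₂ q∣w = contradiction q∣w (residue-∤ w w≢0 p∣w)

  -- The annihilator of a multiple of `d` is the complementary factor `c`, which is a residue below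
  -- `n` because `1 < d`.
  cofactor : ∀ {v : Fin n} {c d} → toℕ v ≢ 0 → d ∣ toℕ v → n ≡ d ℕ.* c → 1 ℕ.< d → .{{NonZero c}} → NonZeroZeroDivisor v
  cofactor {v} {c} {d} v≢0 d∣v n≡dc 1<d =
    v≢0 , w , (λ w≡0 → ℕ.≢-nonZero⁻¹ c (trans (sym toℕw≡c) w≡0)) ,
    ∣⇒IsZeroₙ {n} {v} {w} (subst (_∣ toℕ v ℕ.* toℕ w) (sym n≡dc) (*-pres-∣ d∣v (ℕ.∣-reflexive (sym toℕw≡c))))
    where
    c<n : c ℕ.< n
    c<n = subst (c ℕ.<_) (sym (trans n≡dc (ℕ.*-comm d c))) (ℕ.m<m*n c d 1<d)

    w : Fin n
    w = fromℕ< c<n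

    toℕw≡c : toℕ w ≡ c
    toℕw≡c = toℕ-fromℕ< c<n

  p∣⇒vertex : ∀ {v : Fin n} → NonZeroMultiple p (toℕ v) → NonZeroZeroDivisor v
  p∣⇒vertex {v} (v≢0 , p∣v) = cofactor {v} {q} {p} v≢0 p∣v refl 1<p

  q∣⇒vertex : ∀ {v : Fin n} → NonZeroMultiple q (toℕ v) → NonZeroZeroDivisor v
  q∣⇒vertex {v} (v≢0 , q∣v) = cofactor {v} {p} {q} v≢0 q∣v (ℕ.*-comm p q) 1<q

  Qs Ps : Subset n
  Qs = multiples q n
  Ps = multiples p n

  disjoint : ∀ {v} → v ∈ Qs → ¬ (v ∈ Ps)
  disjoint {v} v∈Q v∈P with ∈-multiples⁻ q v∈Q | ∈-multiples⁻ p v∈P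
  ... | v≢0 , q∣v | _ , p∣v = residue-∤ v v≢0 p∣v q∣v

  -- If two multiples of one prime had product zero, the other prime would divide one of them,
  -- giving a non-zero residue divisible by both.
  ⊆⇒independent : ∀ {S} → S ⊆ Qs ⊎ S ⊆ Ps → Independent (Γ n) S
  ⊆⇒independent (inj₁ S⊆Q) = (λ v v∈S → q∣⇒vertex (∈-multiples⁻ q (S⊆Q v∈S))) , non-adjacent
    where
    non-adjacent : ∀ a b → a ∈ _ → b ∈ _ → _
    non-adjacent a b a∈S b∈S (_ , _ , _ , ab≡0)
      with ∈-multiples⁻ q (S⊆Q a∈S) | ∈-multiples⁻ q (S⊆Q b∈S)
         | euclidsLemma (toℕ a) (toℕ b) p-prime (∣-trans (m∣m*n q) (IsZeroₙ⇒∣ {n} {a} {b} ab≡0))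
    ... | a≢0 , q∣a | _ | inj₁ p∣a = residue-∤ a a≢0 p∣a q∣a
    ... | _ | b≢0 , q∣b | inj₂ p∣b = residue-∤ b b≢0 p∣b q∣b
  ⊆⇒independent (inj₂ S⊆P) = (λ v v∈S → p∣⇒vertex (∈-multiples⁻ p (S⊆P v∈S))) , non-adjacent
    where
    non-adjacent : ∀ a b → a ∈ _ → b ∈ _ → _
    non-adjacent a b a∈S b∈S (_ , _ , _ , ab≡0)
      with ∈-multiples⁻ p (S⊆P a∈S) | ∈-multiples⁻ p (S⊆P b∈S)
         | euclidsLemma (toℕ a) (toℕ b) q-prime (∣-trans (n∣m*n p) (IsZeroₙ⇒∣ {n} {a} {b} ab≡0))
    ... | a≢0 , p∣a | _ | inj₁ q∣a = residue-∤ a a≢0 p∣a q∣a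
    ... | _ | b≢0 , p∣b | inj₂ q∣b = residue-∤ b b≢0 p∣b q∣b

  -- The split is on whether `S` meets `Ps`. If it does not, every vertex of `S` is a multiple of
  -- `q`; if it contains some `u` in `Ps`, a multiple of `q` in `S` would be adjacent to `u`.
  independent⇒⊆ : ∀ {S} → Independent (Γ n) S → S ⊆ Qs ⊎ S ⊆ Ps
  independent⇒⊆ {S} (vertices , non-adjacent) with any? (λ v → (v ∈? S) ×-dec (v ∈? Ps))
  ... | no none = inj₁ S⊆Q
    where
    S⊆Q : S ⊆ Qs
    S⊆Q {v} v∈S with vertex⇒∣ (vertices v v∈S)
    ... | inj₁ p∣v = contradiction (v , v∈S , ∈-multiples⁺ p (proj₁ (vertices v v∈S) , p∣v)) none
    ... | inj₂ q∣v = ∈-multiples⁺ q (proj₁ (vertices v v∈S) , q∣v)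
  ... | yes (u , u∈S , u∈P) = inj₂ S⊆P
    where
    S⊆P : S ⊆ Ps
    S⊆P {v} v∈S with vertex⇒∣ (vertices v v∈S) | ∈-multiples⁻ p u∈P
    ... | inj₁ p∣v | _ = ∈-multiples⁺ p (proj₁ (vertices v v∈S) , p∣v)
    ... | inj₂ q∣v | u≢0 , p∣u = contradiction
      ( vertices u u∈S , vertices v v∈S
      , (λ { refl → residue-∤ u u≢0 p∣u q∣v })
      , ∣⇒IsZeroₙ {n} {u} {v} (*-pres-∣ p∣u q∣v))
      (non-adjacent u v u∈S v∈S)

  evalℚ-I-Γ : ∀ {a b} → suc a ≡ p → suc b ≡ q → ∀ r →
    evalℚ (I (Γ n)) r ≡ (1ℚ ℚ.+ r) ^ a ℚ.+ (1ℚ ℚ.+ r) ^ b ℚ.- 1ℚ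
  evalℚ-I-Γ a+1≡p b+1≡q r =
    trans (evalℚ-I-bipartite (Γ n) disjoint ⊆⇒independent independent⇒⊆ r)
      (cong₂ (λ i j → (1ℚ ℚ.+ r) ^ i ℚ.+ (1ℚ ℚ.+ r) ^ j ℚ.- 1ℚ)
        -- The exponents cross over: there are `p` multiples of `q` below `p * q`, including 0, so
        -- `Qs` has `p - 1` elements.
        (ℕ.suc-injective (trans (suc-card-multiples q p n refl) (sym a+1≡p)))
        (ℕ.suc-injective (trans (suc-card-multiples p q n (ℕ.*-comm p q)) (sym b+1≡q))))

-- Order and powers in ℚ

p≤q⇒0≤q-p : ∀ {p q} → p ℚ.≤ q → 0ℚ ℚ.≤ q ℚ.- p
p≤q⇒0≤q-p {p} {q} p≤q = subst (ℚ._≤ q ℚ.- p) (ℚ.+-inverseʳ p) (ℚ.+-monoˡ-≤ (ℚ.- p) p≤q)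

p<q⇒0<q-p : ∀ {p q} → p ℚ.< q → 0ℚ ℚ.< q ℚ.- p
p<q⇒0<q-p {p} {q} p<q = subst (ℚ._< q ℚ.- p) (ℚ.+-inverseʳ p) (ℚ.+-monoˡ-< (ℚ.- p) p<q)

p+[q-p]≡q : ∀ p q → p ℚ.+ (q ℚ.- p) ≡ q
p+[q-p]≡q = solve 2 (λ p q → p :+ (q :- p) := q) refl

-- The slack is passed separately so that the identity relating it to q - p is left to the ring solver.
≤-slack : ∀ {p q} e → 0ℚ ℚ.≤ e → e ≡ q ℚ.- p → p ℚ.≤ q
≤-slack {p} {q} e 0≤e e≡ = subst₂ ℚ._≤_ (ℚ.+-identityʳ p)
  (trans (cong (p ℚ.+_) e≡) (p+[q-p]≡q p q)) (ℚ.+-monoʳ-≤ p 0≤e)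

<-slack : ∀ {p q} e → 0ℚ ℚ.< e → e ≡ q ℚ.- p → p ℚ.< q
<-slack {p} {q} e 0<e e≡ = subst₂ ℚ._<_ (ℚ.+-identityʳ p)
  (trans (cong (p ℚ.+_) e≡) (p+[q-p]≡q p q)) (ℚ.+-monoʳ-< p 0<e)

0≤-+ : ∀ {p q} → 0ℚ ℚ.≤ p → 0ℚ ℚ.≤ q → 0ℚ ℚ.≤ p ℚ.+ q
0≤-+ = ℚ.+-mono-≤

0≤-* : ∀ {p q} → 0ℚ ℚ.≤ p → 0ℚ ℚ.≤ q → 0ℚ ℚ.≤ p ℚ.* q
0≤-* {p} {q} 0≤p 0≤q = subst (ℚ._≤ p ℚ.* q) (ℚ.*-zeroʳ p)
  (ℚ.*-monoˡ-≤-nonNeg p {{ℚ.nonNegative 0≤p}} 0≤q)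

0<-* : ∀ {p q} → 0ℚ ℚ.< p → 0ℚ ℚ.< q → 0ℚ ℚ.< p ℚ.* q
0<-* {p} {q} 0<p 0<q = subst (ℚ._< p ℚ.* q) (ℚ.*-zeroʳ p)
  (ℚ.*-monoʳ-<-pos p {{ℚ.positive 0<p}} 0<q)

*-mono-≤-nonNeg : ∀ {p q r s} → 0ℚ ℚ.≤ p → 0ℚ ℚ.≤ s → p ℚ.≤ q → r ℚ.≤ s → p ℚ.* r ℚ.≤ q ℚ.* s
*-mono-≤-nonNeg {p} {q} {r} {s} 0≤p 0≤s p≤q r≤s = ℚ.≤-trans
  (ℚ.*-monoˡ-≤-nonNeg p {{ℚ.nonNegative 0≤p}} r≤s)
  (ℚ.*-monoʳ-≤-nonNeg s {{ℚ.nonNegative 0≤s}} p≤q)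

*-cancelˡ-< : ∀ {r p q} → 0ℚ ℚ.< r → r ℚ.* p ℚ.< r ℚ.* q → p ℚ.< q
*-cancelˡ-< {r} 0<r = ℚ.*-cancelˡ-<-nonNeg r {{ℚ.nonNegative (ℚ.<⇒≤ 0<r)}}

0<½*p : ∀ {p} → 0ℚ ℚ.< p → 0ℚ ℚ.< ½ ℚ.* p
0<½*p = 0<-* (ℚ.positive⁻¹ ½)

-- Opaque here and below: a with-abstraction over the result would normalise its rational arithmetic.
opaque
  quotient : ∀ {k} → 0ℚ ℚ.< k → ∀ {d} → 0ℚ ℚ.< d → ∃ λ e → 0ℚ ℚ.< e × k ℚ.* e ≡ d
  quotient {k} 0<k {d} 0<d = 1/k ℚ.* d , 0<-* 0<1/k 0<d ,
    trans (sym (ℚ.*-assoc k 1/k d)) (trans (cong (ℚ._* d) (ℚ.*-inverseʳ k)) (ℚ.*-identityˡ d))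
    where
    instance
      k-pos : ℚ.Positive k
      k-pos = ℚ.positive 0<k

      k≢0 : ℚ.NonZero k
      k≢0 = ℚ.pos⇒nonZero k

    1/k : ℚ
    1/k = ℚ.1/ k

    0<1/k : 0ℚ ℚ.< 1/k
    0<1/k = ℚ.positive⁻¹ 1/k {{ℚ.1/pos⇒pos k}}

p≤∣p∣ : ∀ p → p ℚ.≤ ℚ.∣ p ∣
p≤∣p∣ p with ℚ.≤-total 0ℚ p
... | inj₁ 0≤p = ℚ.≤-reflexive (sym (ℚ.0≤p⇒∣p∣≡p 0≤p))
... | inj₂ p≤0 = ℚ.≤-trans p≤0 (ℚ.0≤∣p∣ p)

-p≤∣p∣ : ∀ p → ℚ.- p ℚ.≤ ℚ.∣ p ∣
-p≤∣p∣ p = subst (ℚ.- p ℚ.≤_) (ℚ.∣-p∣≡∣p∣ p) (p≤∣p∣ (ℚ.- p))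

∣p∣<ε⇒-ε<p : ∀ {p ε} → ℚ.∣ p ∣ ℚ.< ε → ℚ.- ε ℚ.< p
∣p∣<ε⇒-ε<p {p} {ε} ∣p∣<ε = subst (ℚ.- ε ℚ.<_) (solve 1 (λ p → :- (:- p) := p) refl p) (ℚ.neg-antimono-< (ℚ.≤-<-trans (-p≤∣p∣ p) ∣p∣<ε))

∣p-q∣≡∣q-p∣ : ∀ p q → ℚ.∣ p ℚ.- q ∣ ≡ ℚ.∣ q ℚ.- p ∣
∣p-q∣≡∣q-p∣ p q = trans (cong ℚ.∣_∣ (solve 2 (λ p q → p :- q := :- (q :- p)) refl p q)) (ℚ.∣-p∣≡∣p∣ (q ℚ.- p))

Null : (ℕ → ℚ) → Set
Null u = ∀ ε → 0ℚ ℚ.< ε → ∃ λ N → ∀ n → N ℕ.≤ n → ℚ.∣ u n ∣ ℚ.< ε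

both : ∀ {P Q : ℕ → Set} → (∃ λ N → ∀ n → N ℕ.≤ n → P n) → (∃ λ N → ∀ n → N ℕ.≤ n → Q n) →
  ∃ λ N → ∀ n → N ℕ.≤ n → P n × Q n
both (M , p) (N , q) = M ℕ.⊔ N , λ n ≤n →
  p n (ℕ.≤-trans (ℕ.m≤m⊔n M N) ≤n) , q n (ℕ.≤-trans (ℕ.m≤n⊔m M N) ≤n)

opaque
  archimedean : ∀ p → ∃ λ n → p ℚ.< + n ℚ./ 1
  archimedean (mkℚ (+ m) d _) = suc m , ℚ.toℚᵘ-cancel-< (ℚᵘ.<-respʳ-≃
    (ℚᵘ.≃-sym (ℚ.toℚᵘ-fromℚᵘ (mkℚᵘ (+ suc m) 0)))
    (ℚᵘ.*<* (subst₂ ℤ._<_ (sym (ℤ.*-identityʳ (+ m))) (ℤ.pos-* (suc m) (suc d)) (+<+ (ℕ.m≤m*n (suc m) (suc d))))))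
  archimedean p@(mkℚ ℤ.-[1+ _ ] _ _) = 0 , ℚ.negative⁻¹ p

0≤n/1 : ∀ n → 0ℚ ℚ.≤ + n ℚ./ 1
0≤n/1 n = ℚ.nonNegative⁻¹ (+ n ℚ./ 1) {{ℚ.normalize-nonNeg n 1}}

/1-mono-≤ : ∀ {m n} → m ℕ.≤ n → + m ℚ./ 1 ℚ.≤ + n ℚ./ 1
/1-mono-≤ {m} {n} m≤n = subst₂ ℚ._≤_ (ℚ.+-identityʳ (+ m ℚ./ 1))
  (trans (sym (/1-homo-+ m (n ℕ.∸ m))) (cong (λ k → + k ℚ./ 1) (ℕ.m+[n∸m]≡n m≤n)))
  (ℚ.+-monoʳ-≤ (+ m ℚ./ 1) (0≤n/1 (n ℕ.∸ m)))

0≤^ : ∀ {p} → 0ℚ ℚ.≤ p → ∀ k → 0ℚ ℚ.≤ p ^ k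
0≤^ 0≤p zero    = ℚ.nonNegative⁻¹ 1ℚ
0≤^ 0≤p (suc k) = 0≤-* 0≤p (0≤^ 0≤p k)

0<^ : ∀ {p} → 0ℚ ℚ.< p → ∀ k → 0ℚ ℚ.< p ^ k
0<^ 0<p zero    = ℚ.positive⁻¹ 1ℚ
0<^ 0<p (suc k) = 0<-* 0<p (0<^ 0<p k)

^-mono-≤ : ∀ {p q} → 0ℚ ℚ.≤ p → p ℚ.≤ q → ∀ k → p ^ k ℚ.≤ q ^ k
^-mono-≤ 0≤p p≤q zero    = ℚ.≤-refl
^-mono-≤ 0≤p p≤q (suc k) = *-mono-≤-nonNeg 0≤p (0≤^ (ℚ.≤-trans 0≤p p≤q) k) p≤q (^-mono-≤ 0≤p p≤q k)

1^k≡1 : ∀ k → 1ℚ ^ k ≡ 1ℚ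
1^k≡1 zero    = refl
1^k≡1 (suc k) = trans (ℚ.*-identityˡ (1ℚ ^ k)) (1^k≡1 k)

p^k≤1 : ∀ {p} → 0ℚ ℚ.≤ p → p ℚ.≤ 1ℚ → ∀ k → p ^ k ℚ.≤ 1ℚ
p^k≤1 {p} 0≤p p≤1 k = subst (p ^ k ℚ.≤_) (1^k≡1 k) (^-mono-≤ 0≤p p≤1 k)

1≤p^k : ∀ {p} → 1ℚ ℚ.≤ p → ∀ k → 1ℚ ℚ.≤ p ^ k
1≤p^k {p} 1≤p k = subst (ℚ._≤ p ^ k) (1^k≡1 k) (^-mono-≤ (ℚ.nonNegative⁻¹ 1ℚ) 1≤p k)

-- The elementary bound of `n` by the `n`-th power of 2. Combined with `archimedean`, it is enough
-- to make the bisection widths vanish.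
n*½^n≤1 : ∀ n → + n ℚ./ 1 ℚ.* ½ ^ n ℚ.≤ 1ℚ
n*½^n≤1 zero    = ℚ.nonNegative⁻¹ 1ℚ
n*½^n≤1 (suc n) = subst₂ ℚ._≤_
  (trans (solve 2 (λ a t → con ½ :* (t :+ a :* t) := (con 1ℚ :+ a) :* (con ½ :* t)) refl (+ n ℚ./ 1) (½ ^ n))
    (cong (ℚ._* (½ ℚ.* ½ ^ n)) (sym (/1-homo-+ 1 n))))
  refl
  (ℚ.*-monoˡ-≤-nonNeg ½ (ℚ.+-mono-≤ (p^k≤1 (ℚ.nonNegative⁻¹ ½) (from-yes (½ ℚ.≤? 1ℚ)) n) (n*½^n≤1 n)))

opaque
  ½^n*w-vanishes : ∀ w {ε} → 0ℚ ℚ.≤ w → 0ℚ ℚ.< ε → ∃ λ N → ∀ n → N ℕ.≤ n → ½ ^ n ℚ.* w ℚ.< ε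
  -- The index must exceed `(w + 1) / ε`. Adding 1 keeps this quotient positive even when `w` is 0.
  ½^n*w-vanishes w {ε} 0≤w 0<ε with quotient 0<ε {w ℚ.+ 1ℚ} (ℚ.+-mono-≤-< 0≤w (ℚ.positive⁻¹ 1ℚ))
  ... | d , 0<d , ε*d≡w+1 with archimedean d
  ... | N , d<N = N , λ n N≤n →
    let d<n = ℚ.<-≤-trans d<N (/1-mono-≤ N≤n) in
    *-cancelˡ-< (ℚ.<-trans 0<d d<n) (begin-strict
      + n ℚ./ 1 ℚ.* (½ ^ n ℚ.* w)   ≡⟨ ℚ.*-assoc (+ n ℚ./ 1) (½ ^ n) w ⟨
      + n ℚ./ 1 ℚ.* ½ ^ n ℚ.* w     ≤⟨ ℚ.*-monoʳ-≤-nonNeg w {{ℚ.nonNegative 0≤w}} (n*½^n≤1 n) ⟩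
      1ℚ ℚ.* w                      ≡⟨ trans (ℚ.*-identityˡ w) (sym (ℚ.+-identityʳ w)) ⟩
      w ℚ.+ 0ℚ                      <⟨ ℚ.+-monoʳ-< w (ℚ.positive⁻¹ 1ℚ) ⟩
      w ℚ.+ 1ℚ                      ≡⟨ ε*d≡w+1 ⟨
      ε ℚ.* d                       <⟨ ℚ.*-monoʳ-<-pos ε {{ℚ.positive 0<ε}} d<n ⟩
      ε ℚ.* (+ n ℚ./ 1)             ≡⟨ ℚ.*-comm ε (+ n ℚ./ 1) ⟩
      + n ℚ./ 1 ℚ.* ε               ∎)
    where open ℚ.≤-Reasoning

-- Bisection

p+q-p≡q : ∀ p q → p ℚ.+ q ℚ.- p ≡ q
p+q-p≡q = solve 2 (λ p q → p :+ q :- p := q) refl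

p≡p-q--q : ∀ p q → p ≡ p ℚ.- q ℚ.- ℚ.- q
p≡p-q--q = solve 2 (λ p q → p := p :- q :- :- q) refl

¼ : ℚ
¼ = ½ ℚ.* ½

-- The constants `c` and `K` play the role of lower and upper bounds on a derivative. Expansion is
-- required on the whole ray from `l`, since a foreign sequence of approximate zeros is not known to
-- stay below `h`; the Lipschitz bound concerns only points of the bracket.
record SimpleRoot (g : ℚ → ℚ) : Set where
  field
    l h c K   : ℚ
    l≤h       : l ℚ.≤ h
    g[l]<0    : g l ℚ.< 0ℚ
    0<g[h]    : 0ℚ ℚ.< g h
    0<c       : 0ℚ ℚ.< c
    expanding : ∀ {s t} → l ℚ.≤ s → s ℚ.≤ t → c ℚ.* (t ℚ.- s) ℚ.≤ g t ℚ.- g s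
    0<K       : 0ℚ ℚ.< K
    lipschitz : ∀ {s t} → l ℚ.≤ s → s ℚ.≤ t → t ℚ.≤ h → g t ℚ.- g s ℚ.≤ K ℚ.* (t ℚ.- s)
    ½≤l       : ½ ℚ.≤ l
    -- Near 0 the function g need not expand; this keeps approximate zeros away from there.
    l-barrier : ∀ {t} → 0ℚ ℚ.≤ t → ℚ.- ¼ ℚ.< g t → l ℚ.≤ t

module _ {g : ℚ → ℚ} (R : SimpleRoot g) where
  open SimpleRoot R

  expanding-∣∣ : ∀ {s t} → l ℚ.≤ s → l ℚ.≤ t → c ℚ.* ℚ.∣ s ℚ.- t ∣ ℚ.≤ ℚ.∣ g s ∣ ℚ.+ ℚ.∣ g t ∣
  expanding-∣∣ {s} {t} l≤s l≤t with ℚ.≤-total s t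
  ... | inj₁ s≤t = begin
    c ℚ.* ℚ.∣ s ℚ.- t ∣        ≡⟨ cong (c ℚ.*_) (trans (∣p-q∣≡∣q-p∣ s t) (ℚ.0≤p⇒∣p∣≡p (p≤q⇒0≤q-p s≤t))) ⟩
    c ℚ.* (t ℚ.- s)            ≤⟨ expanding l≤s s≤t ⟩
    g t ℚ.- g s                ≡⟨ ℚ.+-comm (g t) (ℚ.- g s) ⟩
    ℚ.- g s ℚ.+ g t            ≤⟨ ℚ.+-mono-≤ (-p≤∣p∣ (g s)) (p≤∣p∣ (g t)) ⟩
    ℚ.∣ g s ∣ ℚ.+ ℚ.∣ g t ∣    ∎
    where open ℚ.≤-Reasoning
  ... | inj₂ t≤s = begin
    c ℚ.* ℚ.∣ s ℚ.- t ∣        ≡⟨ cong (c ℚ.*_) (ℚ.0≤p⇒∣p∣≡p (p≤q⇒0≤q-p t≤s)) ⟩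
    c ℚ.* (s ℚ.- t)            ≤⟨ expanding l≤t t≤s ⟩
    g s ℚ.- g t                ≤⟨ ℚ.+-mono-≤ (p≤∣p∣ (g s)) (-p≤∣p∣ (g t)) ⟩
    ℚ.∣ g s ∣ ℚ.+ ℚ.∣ g t ∣    ∎
    where open ℚ.≤-Reasoning

  opaque
    near-zeros-are-close : ∀ {ε} → 0ℚ ℚ.< ε → ∃ λ δ → 0ℚ ℚ.< δ × ∀ {s t} →
      l ℚ.≤ s → l ℚ.≤ t → ℚ.∣ g s ∣ ℚ.< δ → ℚ.∣ g t ∣ ℚ.< δ → ℚ.∣ s ℚ.- t ∣ ℚ.< ε
    near-zeros-are-close {ε} 0<ε = ½ ℚ.* (c ℚ.* ε) , 0<½*p (0<-* 0<c 0<ε) , λ l≤s l≤t gs<δ gt<δ →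
      *-cancelˡ-< 0<c (ℚ.≤-<-trans (expanding-∣∣ l≤s l≤t)
        (subst (_ ℚ.<_) (solve 1 (λ x → con ½ :* x :+ con ½ :* x := x) refl (c ℚ.* ε)) (ℚ.+-mono-< gs<δ gt<δ)))

  -- A sign change on `[s, s + w]`. The width is a parameter, so that its exact value after `n`
  -- halvings is part of the type.
  Bracket : ℚ → Set
  Bracket w = ∃ λ s → l ℚ.≤ s × s ℚ.+ w ℚ.≤ h × g s ℚ.≤ 0ℚ × 0ℚ ℚ.≤ g (s ℚ.+ w)

  -- Bisection is constructive here because midpoints and their values are rational, so the sign at
  -- a midpoint is decidable.
  halve : ∀ {w} → 0ℚ ℚ.≤ w → Bracket w → Bracket (½ ℚ.* w)
  halve {w} 0≤w (s , l≤s , s+w≤h , gs≤0 , 0≤g) with g (s ℚ.+ ½ ℚ.* w) ℚ.≤? 0ℚ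
  ... | yes gm≤0 = s ℚ.+ ½ ℚ.* w , ℚ.≤-trans l≤s (≤-slack (½ ℚ.* w) (0≤-* (ℚ.nonNegative⁻¹ ½) 0≤w)
                     (solve 2 (λ s v → v := s :+ v :- s) refl s (½ ℚ.* w)))
                 , subst (ℚ._≤ h) (sym m+½w≡) s+w≤h , gm≤0 , subst (λ t → 0ℚ ℚ.≤ g t) (sym m+½w≡) 0≤g
    where
    m+½w≡ : s ℚ.+ ½ ℚ.* w ℚ.+ ½ ℚ.* w ≡ s ℚ.+ w
    m+½w≡ = solve 2 (λ s w → s :+ con ½ :* w :+ con ½ :* w := s :+ w) refl s w
  ... | no gm≰0 = s , l≤s
                , ℚ.≤-trans (≤-slack (½ ℚ.* w) (0≤-* (ℚ.nonNegative⁻¹ ½) 0≤w)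
                    (solve 2 (λ s w → con ½ :* w := s :+ w :- (s :+ con ½ :* w)) refl s w)) s+w≤h
                , gs≤0 , ℚ.<⇒≤ (ℚ.≰⇒> gm≰0)

  width : ℕ → ℚ
  width n = ½ ^ n ℚ.* (h ℚ.- l)

  0≤width : ∀ n → 0ℚ ℚ.≤ width n
  0≤width n = 0≤-* (0≤^ (ℚ.nonNegative⁻¹ ½) n) (p≤q⇒0≤q-p l≤h)

  opaque
    bracket : ∀ n → Bracket (width n)
    bracket zero    = l , ℚ.≤-refl , ℚ.≤-reflexive l+w≡h , ℚ.<⇒≤ g[l]<0
                    , subst (λ t → 0ℚ ℚ.≤ g t) (sym l+w≡h) (ℚ.<⇒≤ 0<g[h])
      where
      l+w≡h : l ℚ.+ width 0 ≡ h
      l+w≡h = trans (cong (l ℚ.+_) (ℚ.*-identityˡ (h ℚ.- l))) (p+[q-p]≡q l h)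
    bracket (suc n) = subst Bracket (sym (ℚ.*-assoc ½ (½ ^ n) (h ℚ.- l))) (halve (0≤width n) (bracket n))

  root : ℕ → ℚ
  root n = proj₁ (bracket n)

  l≤root : ∀ n → l ℚ.≤ root n
  l≤root n = proj₁ (proj₂ (bracket n))

  root≤root+width : ∀ n → root n ℚ.≤ root n ℚ.+ width n
  root≤root+width n = ≤-slack (width n) (0≤width n) (solve 2 (λ s w → w := s :+ w :- s) refl (root n) (width n))

  root≤h : ∀ n → root n ℚ.≤ h
  root≤h n = ℚ.≤-trans (root≤root+width n) (proj₁ (proj₂ (proj₂ (bracket n))))

  opaque
    -- Since `g` is non-negative at the right end of the bracket, `- g s` is at most the increment
    -- of `g` over the bracket, hence at most `K` times the width.
    g[root]-null : Null (g ∘ root)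
    g[root]-null ε 0<ε with quotient 0<K 0<ε
    ... | e , 0<e , K*e≡ε with ½^n*w-vanishes (h ℚ.- l) (p≤q⇒0≤q-p l≤h) 0<e
    ... | N , width<e = N , λ n N≤n → ∣g∣<ε n (width<e n N≤n)
      where
      open ℚ.≤-Reasoning
      ∣g∣<ε : ∀ n → width n ℚ.< e → ℚ.∣ g (root n) ∣ ℚ.< ε
      ∣g∣<ε n w<e = let s , l≤s , s+w≤h , gs≤0 , 0≤g = bracket n in begin-strict
        ℚ.∣ g s ∣                            ≡⟨ ℚ.∣-p∣≡∣p∣ (g s) ⟨
        ℚ.∣ ℚ.- g s ∣                        ≡⟨ ℚ.0≤p⇒∣p∣≡p (ℚ.neg-antimono-≤ gs≤0) ⟩
        ℚ.- g s                              ≤⟨ ≤-slack (g (s ℚ.+ width n)) 0≤g (p≡p-q--q (g (s ℚ.+ width n)) (g s)) ⟩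
        g (s ℚ.+ width n) ℚ.- g s            ≤⟨ lipschitz l≤s (root≤root+width n) s+w≤h ⟩
        K ℚ.* (s ℚ.+ width n ℚ.- s)          ≡⟨ cong (K ℚ.*_) (p+q-p≡q s (width n)) ⟩
        K ℚ.* width n                        <⟨ ℚ.*-monoʳ-<-pos K {{ℚ.positive 0<K}} w<e ⟩
        K ℚ.* e                              ≡⟨ K*e≡ε ⟩
        ε                                    ∎

  root-cauchy : IsCauchy root
  root-cauchy ε 0<ε with near-zeros-are-close 0<ε
  ... | δ , 0<δ , close with g[root]-null δ 0<δ
  ... | N , small = N , λ m n N≤m N≤n → close (l≤root m) (l≤root n) (small m N≤m) (small n N≤n)

  -- Once the tail of `t` is known to stay in the expanding region, `near-zeros-are-close` compares
  -- it with `root`. The smallness, nearness and sign conditions at `N` confine that tail.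
  attracted : ∀ (t : ℕ → ℚ) N → (∀ n → N ℕ.≤ n → ℚ.∣ g (t n) ∣ ℚ.< ¼) →
    (∀ n → N ℕ.≤ n → ℚ.∣ t N ℚ.- t n ∣ ℚ.< ½) → 0ℚ ℚ.≤ t N → Null (g ∘ t) → Null (λ n → t n ℚ.- root n)
  attracted t N small near 0≤tN null ε 0<ε with near-zeros-are-close 0<ε
  ... | δ , 0<δ , close with both (both (null δ 0<δ) (g[root]-null δ 0<δ)) (N , λ _ N≤n → N≤n)
  ... | M , p = M , λ n M≤n → let (gt<δ , groot<δ) , N≤n = p n M≤n in
      close (l≤t n N≤n) (l≤root n) gt<δ groot<δ
    where
    barrier : ∀ n → N ℕ.≤ n → 0ℚ ℚ.≤ t n → l ℚ.≤ t n
    barrier n N≤n 0≤tn = l-barrier 0≤tn (∣p∣<ε⇒-ε<p (small n N≤n))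

    l≤t : ∀ n → N ℕ.≤ n → l ℚ.≤ t n
    -- The barrier is applied twice. At `N` it gives `t N ≥ l ≥ ½`; moving by less than `½` then
    -- leaves `t n` positive, so the barrier applies to `t n` as well.
    l≤t n N≤n = barrier n N≤n (ℚ.<⇒≤ (<-slack (½ ℚ.- (t N ℚ.- t n) ℚ.+ (t N ℚ.- ½))
      (ℚ.+-mono-<-≤ (p<q⇒0<q-p (ℚ.≤-<-trans (p≤∣p∣ (t N ℚ.- t n)) (near n N≤n)))
                    (p≤q⇒0≤q-p (ℚ.≤-trans ½≤l (barrier N ℕ.≤-refl 0≤tN))))
      (solve 2 (λ a b → con ½ :- (a :- b) :+ (a :- con ½) := b :- con 0ℚ) refl (t N) (t n))))

  opaque
    -- The order on reals demands a uniform gap. With `- g l` and `g h` both at least `2η`, a point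
    -- where `g` is below `η` in absolute value has values more than `η` away from those at the
    -- ends, so the Lipschitz bound keeps it farther than `η / K` from both ends.
    root-gaps : ∃ λ e → 0ℚ ℚ.< e × ∃ λ N → ∀ n → N ℕ.≤ n → l ℚ.+ e ℚ.< root n × root n ℚ.+ e ℚ.< h
    root-gaps = e , 0<e , map₂ (λ p n N≤n → below n (p n N≤n) , above n (p n N≤n)) (g[root]-null η 0<η)
      where
      open ℚ.≤-Reasoning
      η : ℚ
      η = ½ ℚ.* (ℚ.- g l ℚ.⊓ g h)

      0<⊓ : 0ℚ ℚ.< ℚ.- g l ℚ.⊓ g h
      0<⊓ with ℚ.≤-total (ℚ.- g l) (g h)
      ... | inj₁ ≤ = subst (0ℚ ℚ.<_) (sym (ℚ.p≤q⇒p⊓q≡p ≤)) (ℚ.neg-antimono-< g[l]<0)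
      ... | inj₂ ≥ = subst (0ℚ ℚ.<_) (sym (ℚ.p≥q⇒p⊓q≡q ≥)) 0<g[h]

      0<η : 0ℚ ℚ.< η
      0<η = 0<½*p 0<⊓

      e : ℚ
      e = proj₁ (quotient 0<K 0<η)

      0<e : 0ℚ ℚ.< e
      0<e = proj₁ (proj₂ (quotient 0<K 0<η))

      K*e≡η : K ℚ.* e ≡ η
      K*e≡η = proj₂ (proj₂ (quotient 0<K 0<η))

      η+η≤ : ∀ {x} → ℚ.- g l ℚ.⊓ g h ℚ.≤ x → η ℚ.≤ x ℚ.- η
      η+η≤ {x} ⊓≤x = ≤-slack (x ℚ.- (ℚ.- g l ℚ.⊓ g h)) (p≤q⇒0≤q-p ⊓≤x)
        (solve 2 (λ x y → x :- y := x :- con ½ :* y :- con ½ :* y) refl x (ℚ.- g l ℚ.⊓ g h))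

      below : ∀ n → ℚ.∣ g (root n) ∣ ℚ.< η → l ℚ.+ e ℚ.< root n
      below n small = <-slack (root n ℚ.- l ℚ.- e) (p<q⇒0<q-p (*-cancelˡ-< 0<K (begin-strict
        K ℚ.* e                   ≡⟨ K*e≡η ⟩
        η                         ≤⟨ η+η≤ (ℚ.p⊓q≤p (ℚ.- g l) (g h)) ⟩
        ℚ.- g l ℚ.- η             <⟨ ℚ.+-monoʳ-< (ℚ.- g l) (∣p∣<ε⇒-ε<p small) ⟩
        ℚ.- g l ℚ.+ g (root n)    ≡⟨ ℚ.+-comm (ℚ.- g l) (g (root n)) ⟩
        g (root n) ℚ.- g l        ≤⟨ lipschitz ℚ.≤-refl (l≤root n) (root≤h n) ⟩
        K ℚ.* (root n ℚ.- l)      ∎)))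
        (solve 3 (λ r l e → r :- l :- e := r :- (l :+ e)) refl (root n) l e)

      above : ∀ n → ℚ.∣ g (root n) ∣ ℚ.< η → root n ℚ.+ e ℚ.< h
      above n small = <-slack (h ℚ.- root n ℚ.- e) (p<q⇒0<q-p (*-cancelˡ-< 0<K (begin-strict
        K ℚ.* e                   ≡⟨ K*e≡η ⟩
        η                         ≤⟨ η+η≤ (ℚ.p⊓q≤q (ℚ.- g l) (g h)) ⟩
        g h ℚ.- η                 <⟨ ℚ.+-monoʳ-< (g h) (ℚ.neg-antimono-< (ℚ.≤-<-trans (p≤∣p∣ (g (root n))) small)) ⟩
        g h ℚ.- g (root n)        ≤⟨ lipschitz (l≤root n) (root≤h n) ℚ.≤-refl ⟩
        K ℚ.* (h ℚ.- root n)      ∎)))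
        (solve 3 (λ r h e → h :- r :- e := h :- (r :+ e)) refl (root n) h e)

-- Real zeros of a polynomial on either side of -1

module TwoZeros (P : Polynomial) {g⁺ g⁻ : ℚ → ℚ} (R⁺ : SimpleRoot g⁺) (R⁻ : SimpleRoot g⁻)
  (P≗g⁺ : ∀ r → evalℚ P r ≡ g⁺ (1ℚ ℚ.+ r)) (P≗g⁻ : ∀ r → evalℚ P r ≡ g⁻ (ℚ.- (1ℚ ℚ.+ r))) where
  private
    module R⁺ = SimpleRoot R⁺
    module R⁻ = SimpleRoot R⁻

  -- Here `g⁺` is `P` in the variable `y = 1 + x` and `g⁻` is `P` in `t = - (1 + x)`; the zeros undo
  -- these substitutions.
  x⁺ x⁻ : ℝ
  x⁺ = mkℝ (λ n → root R⁺ n ℚ.- 1ℚ) λ ε 0<ε → map₂ (λ p m n N≤m N≤n →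
    subst (λ t → ℚ.∣ t ∣ ℚ.< ε) (solve 2 (λ a b → a :- b := a :- con 1ℚ :- (b :- con 1ℚ)) refl (root R⁺ m) (root R⁺ n)) (p m n N≤m N≤n))
    (root-cauchy R⁺ ε 0<ε)
  x⁻ = mkℝ (λ n → ℚ.- root R⁻ n ℚ.- 1ℚ) λ ε 0<ε → map₂ (λ p m n N≤m N≤n →
    subst (λ t → ℚ.∣ t ∣ ℚ.< ε) (solve 2 (λ a b → b :- a := :- a :- con 1ℚ :- (:- b :- con 1ℚ)) refl (root R⁻ m) (root R⁻ n)) (p n m N≤n N≤m))
    (root-cauchy R⁻ ε 0<ε)

  IsZero⇒Null : ∀ z → IsZero P z → Null (λ n → evalℚ P (seq z n))
  IsZero⇒Null z z-zero ε 0<ε = map₂ (λ p n N≤n →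
    subst (λ t → ℚ.∣ t ∣ ℚ.< ε) (trans (ℚ.+-identityʳ _) (seq-eval P z n)) (p n N≤n)) (z-zero ε 0<ε)

  Null⇒IsZero : ∀ z → Null (λ n → evalℚ P (seq z n)) → IsZero P z
  Null⇒IsZero z null ε 0<ε = map₂ (λ p n N≤n →
    subst (λ t → ℚ.∣ t ∣ ℚ.< ε) (sym (trans (ℚ.+-identityʳ _) (seq-eval P z n))) (p n N≤n)) (null ε 0<ε)

  Null-cong : ∀ {u v} → (∀ n → ℚ.∣ u n ∣ ≡ ℚ.∣ v n ∣) → Null u → Null v
  Null-cong u≗v null ε 0<ε = map₂ (λ p n N≤n → subst (ℚ._< ε) (u≗v n) (p n N≤n)) (null ε 0<ε)

  x⁺-zero : IsZero P x⁺
  x⁺-zero = Null⇒IsZero x⁺ (Null-cong (λ n → cong ℚ.∣_∣ (sym (trans (P≗g⁺ (seq x⁺ n))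
    (cong g⁺ (solve 1 (λ t → con 1ℚ :+ (t :- con 1ℚ) := t) refl (root R⁺ n)))))) (g[root]-null R⁺))

  x⁻-zero : IsZero P x⁻
  x⁻-zero = Null⇒IsZero x⁻ (Null-cong (λ n → cong ℚ.∣_∣ (sym (trans (P≗g⁻ (seq x⁻ n))
    (cong g⁻ (solve 1 (λ t → :- (con 1ℚ :+ (:- t :- con 1ℚ)) := t) refl (root R⁻ n)))))) (g[root]-null R⁻))

  x⁺-interval : ∀ {i j} → i ℚ./ 1 ℚ.≤ R⁺.l ℚ.- 1ℚ → R⁺.h ℚ.- 1ℚ ℚ.≤ j ℚ./ 1 → InInterval i j x⁺
  x⁺-interval {i} {j} i≤ ≤j with root-gaps R⁺
  ... | e , 0<e , N , gaps =
    (e , 0<e , N , λ n N≤n → ℚ.≤-<-trans (ℚ.+-monoˡ-≤ e i≤)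
      (subst (ℚ._< seq x⁺ n) (swap R⁺.l e) (ℚ.+-monoˡ-< (ℚ.- 1ℚ) (proj₁ (gaps n N≤n))))) ,
    (e , 0<e , N , λ n N≤n → ℚ.<-≤-trans
      (subst (ℚ._< R⁺.h ℚ.- 1ℚ) (swap (root R⁺ n) e) (ℚ.+-monoˡ-< (ℚ.- 1ℚ) (proj₂ (gaps n N≤n)))) ≤j)
    where
    swap : ∀ a e → a ℚ.+ e ℚ.- 1ℚ ≡ a ℚ.- 1ℚ ℚ.+ e
    swap = solve 2 (λ a e → a :+ e :- con 1ℚ := a :- con 1ℚ :+ e) refl

  x⁻-interval : ∀ {i j} → i ℚ./ 1 ℚ.≤ ℚ.- R⁻.h ℚ.- 1ℚ → ℚ.- R⁻.l ℚ.- 1ℚ ℚ.≤ j ℚ./ 1 → InInterval i j x⁻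
  x⁻-interval {i} {j} i≤ ≤j with root-gaps R⁻
  ... | e , 0<e , N , gaps =
    (e , 0<e , N , λ n N≤n → ℚ.≤-<-trans (ℚ.+-monoˡ-≤ e i≤)
      (flip R⁻.h (root R⁻ n) e (proj₂ (gaps n N≤n)))) ,
    (e , 0<e , N , λ n N≤n → ℚ.<-≤-trans (flip (root R⁻ n) R⁻.l e (proj₁ (gaps n N≤n))) ≤j)
    where
    flip : ∀ a b e → b ℚ.+ e ℚ.< a → ℚ.- a ℚ.- 1ℚ ℚ.+ e ℚ.< ℚ.- b ℚ.- 1ℚ
    flip a b e b+e<a = <-slack (a ℚ.- (b ℚ.+ e)) (p<q⇒0<q-p b+e<a)
      (solve 3 (λ a b e → a :- (b :+ e) := :- b :- con 1ℚ :- (:- a :- con 1ℚ :+ e)) refl a b e)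

  -- Both roots are at least `½`, so the terms of `x⁺` are at least `-½` and those of `x⁻` at most
  -- `-3/2`. The gap of at least 1 refutes closeness within `½`.
  x⁺≉x⁻ : ¬ (x⁺ ≈ x⁻)
  x⁺≉x⁻ x⁺≈x⁻ with x⁺≈x⁻ ½ (ℚ.positive⁻¹ ½)
  ... | N , p = ℚ.<-irrefl refl (ℚ.<-trans (p N ℕ.≤-refl) (ℚ.<-≤-trans ½<gap (p≤∣p∣ (seq x⁺ N ℚ.- seq x⁻ N))))
    where
    ½<gap : ½ ℚ.< seq x⁺ N ℚ.- seq x⁻ N
    ½<gap = <-slack ((root R⁺ N ℚ.- ½) ℚ.+ (root R⁻ N ℚ.- ½) ℚ.+ ½)
      (ℚ.+-mono-≤-< (0≤-+ (p≤q⇒0≤q-p (ℚ.≤-trans R⁺.½≤l (l≤root R⁺ N))) (p≤q⇒0≤q-p (ℚ.≤-trans R⁻.½≤l (l≤root R⁻ N)))) (ℚ.positive⁻¹ ½))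
      (solve 2 (λ a b → (a :- con ½) :+ (b :- con ½) :+ con ½ := a :- con 1ℚ :- (:- b :- con 1ℚ) :- con ½) refl (root R⁺ N) (root R⁻ N))

  1+-diff : ∀ a b → a ℚ.- b ≡ (1ℚ ℚ.+ a) ℚ.- (1ℚ ℚ.+ b)
  1+-diff = solve 2 (λ a b → a :- b := con 1ℚ :+ a :- (con 1ℚ :+ b)) refl

  -[1+]-diff : ∀ a b → b ℚ.- a ≡ ℚ.- (1ℚ ℚ.+ a) ℚ.- ℚ.- (1ℚ ℚ.+ b)
  -[1+]-diff = solve 2 (λ a b → b :- a := :- (con 1ℚ :+ a) :- :- (con 1ℚ :+ b)) refl

  -- The sign of the real `1 + z` is not decidable, but that of its rational term at `M` is. The
  -- index `M` is late enough for the `¼` and `½` bounds of `attracted`, which make this one sign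
  -- settle the whole tail.
  zeros : ∀ z → IsZero P z → z ≈ x⁺ ⊎ z ≈ x⁻
  zeros z z-zero = decide (0ℚ ℚ.≤? 1ℚ ℚ.+ seq z M)
    where
    P-null : Null (λ n → evalℚ P (seq z n))
    P-null = IsZero⇒Null z z-zero

    M₁ M₂ M : ℕ
    M₁ = proj₁ (P-null ¼ (ℚ.positive⁻¹ ¼))
    M₂ = proj₁ (cauchy z ½ (ℚ.positive⁻¹ ½))
    M  = M₁ ℕ.⊔ M₂

    small : ∀ n → M ℕ.≤ n → ℚ.∣ evalℚ P (seq z n) ∣ ℚ.< ¼
    small n M≤n = proj₂ (P-null ¼ (ℚ.positive⁻¹ ¼)) n (ℕ.m⊔n≤o⇒m≤o M₁ M₂ M≤n)

    near : ∀ m n → M ℕ.≤ m → M ℕ.≤ n → ℚ.∣ seq z m ℚ.- seq z n ∣ ℚ.< ½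
    near m n M≤m M≤n = proj₂ (cauchy z ½ (ℚ.positive⁻¹ ½)) m n
      (ℕ.m⊔n≤o⇒n≤o M₁ M₂ M≤m) (ℕ.m⊔n≤o⇒n≤o M₁ M₂ M≤n)

    decide : Dec (0ℚ ℚ.≤ 1ℚ ℚ.+ seq z M) → z ≈ x⁺ ⊎ z ≈ x⁻
    decide (yes 0≤) = inj₁ (Null-cong
      (λ n → cong ℚ.∣_∣ (solve 2 (λ a r → con 1ℚ :+ a :- r := a :- (r :- con 1ℚ)) refl (seq z n) (root R⁺ n)))
      (attracted R⁺ (λ n → 1ℚ ℚ.+ seq z n) M
        (λ n M≤n → subst (λ t → ℚ.∣ t ∣ ℚ.< ¼) (P≗g⁺ (seq z n)) (small n M≤n))
        (λ n M≤n → subst (λ t → ℚ.∣ t ∣ ℚ.< ½) (1+-diff (seq z M) (seq z n)) (near M n ℕ.≤-refl M≤n))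
        0≤
        (Null-cong (λ n → cong ℚ.∣_∣ (P≗g⁺ (seq z n))) P-null)))
    decide (no 0≰) = inj₂ (Null-cong
      (λ n → trans (∣p-q∣≡∣q-p∣ (ℚ.- (1ℚ ℚ.+ seq z n)) (root R⁻ n))
        (cong ℚ.∣_∣ (solve 2 (λ a r → r :- :- (con 1ℚ :+ a) := a :- (:- r :- con 1ℚ)) refl (seq z n) (root R⁻ n))))
      (attracted R⁻ (λ n → ℚ.- (1ℚ ℚ.+ seq z n)) M
        (λ n M≤n → subst (λ t → ℚ.∣ t ∣ ℚ.< ¼) (P≗g⁻ (seq z n)) (small n M≤n))
        (λ n M≤n → subst (λ t → ℚ.∣ t ∣ ℚ.< ½) (-[1+]-diff (seq z M) (seq z n)) (near n M M≤n ℕ.≤-refl))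
        (ℚ.neg-antimono-≤ (ℚ.<⇒≤ (ℚ.≰⇒> 0≰)))
        (Null-cong (λ n → cong ℚ.∣_∣ (P≗g⁻ (seq z n))) P-null)))

  exactly-two-zeros : ExactlyTwoZeros P x⁺ x⁻
  exactly-two-zeros = x⁺-zero , x⁻-zero , x⁺≉x⁻ , zeros

-- The zeros of y^(a+1) + y^(b+2) - 1

0≤½ : 0ℚ ℚ.≤ ½
0≤½ = ℚ.nonNegative⁻¹ ½

0≤1 : 0ℚ ℚ.≤ 1ℚ
0≤1 = ℚ.nonNegative⁻¹ 1ℚ

2ℚ : ℚ
2ℚ = 1ℚ ℚ.+ 1ℚ

-- The increment of the power `k + 1` equals `t ^ k * (t - s) + s * (t ^ k - s ^ k)`. The first term
-- dominates `l ^ k * (t - s)` and the second is non-negative.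
^-expanding : ∀ {l s t} → 0ℚ ℚ.≤ l → l ℚ.≤ s → s ℚ.≤ t → ∀ k →
  l ^ k ℚ.* (t ℚ.- s) ℚ.≤ t ^ suc k ℚ.- s ^ suc k
^-expanding {l} {s} {t} 0≤l l≤s s≤t k = ≤-slack
  ((t ^ k ℚ.- l ^ k) ℚ.* (t ℚ.- s) ℚ.+ s ℚ.* (t ^ k ℚ.- s ^ k))
  (0≤-+ (0≤-* (p≤q⇒0≤q-p (^-mono-≤ 0≤l (ℚ.≤-trans l≤s s≤t) k)) (p≤q⇒0≤q-p s≤t))
        (0≤-* 0≤s (p≤q⇒0≤q-p (^-mono-≤ 0≤s s≤t k))))
  (identity l s t (l ^ k) (s ^ k) (t ^ k))
  where
  0≤s : 0ℚ ℚ.≤ s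
  0≤s = ℚ.≤-trans 0≤l l≤s

  identity : ∀ l s t L S T → (T ℚ.- L) ℚ.* (t ℚ.- s) ℚ.+ s ℚ.* (T ℚ.- S) ≡ (t ℚ.* T ℚ.- s ℚ.* S) ℚ.- L ℚ.* (t ℚ.- s)
  identity = solve 6 (λ l s t L S T →
    (T :- L) :* (t :- s) :+ s :* (T :- S) := (t :* T :- s :* S) :- L :* (t :- s)) refl

opaque
  -- A discrete product rule: the next increment is `t * (t ^ k - s ^ k) + s ^ k * (t - s)`, whence
  -- the recursion `h * K + h ^ k` for the constant.
  ^-lipschitz : ∀ {h} → 0ℚ ℚ.< h → ∀ k → ∃ λ K → 0ℚ ℚ.< K × ∀ {s t} →
    0ℚ ℚ.≤ s → s ℚ.≤ t → t ℚ.≤ h → t ^ k ℚ.- s ^ k ℚ.≤ K ℚ.* (t ℚ.- s)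
  -- The increment is 0 here; 1 is chosen because the constant has to be positive.
  ^-lipschitz 0<h zero = 1ℚ , ℚ.positive⁻¹ 1ℚ , λ {s} {t} _ s≤t _ →
    subst (0ℚ ℚ.≤_) (sym (ℚ.*-identityˡ (t ℚ.- s))) (p≤q⇒0≤q-p s≤t)
  ^-lipschitz {h} 0<h (suc k) with ^-lipschitz 0<h k
  ... | K , 0<K , lip = h ℚ.* K ℚ.+ h ^ k , ℚ.+-mono-< (0<-* 0<h 0<K) (0<^ 0<h k) , λ {s} {t} 0≤s s≤t t≤h →
    ≤-slack
      (h ℚ.* (K ℚ.* (t ℚ.- s) ℚ.- (t ^ k ℚ.- s ^ k)) ℚ.+ (h ℚ.- t) ℚ.* (t ^ k ℚ.- s ^ k) ℚ.+ (h ^ k ℚ.- s ^ k) ℚ.* (t ℚ.- s))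
      (0≤-+ (0≤-+ (0≤-* (ℚ.<⇒≤ 0<h) (p≤q⇒0≤q-p (lip 0≤s s≤t t≤h)))
                  (0≤-* (p≤q⇒0≤q-p t≤h) (p≤q⇒0≤q-p (^-mono-≤ 0≤s s≤t k))))
            (0≤-* (p≤q⇒0≤q-p (^-mono-≤ 0≤s (ℚ.≤-trans s≤t t≤h) k)) (p≤q⇒0≤q-p s≤t)))
      (identity h K s t (h ^ k) (s ^ k) (t ^ k))
    where
    identity : ∀ h K s t H S T →
      h ℚ.* (K ℚ.* (t ℚ.- s) ℚ.- (T ℚ.- S)) ℚ.+ (h ℚ.- t) ℚ.* (T ℚ.- S) ℚ.+ (H ℚ.- S) ℚ.* (t ℚ.- s)
        ≡ (h ℚ.* K ℚ.+ H) ℚ.* (t ℚ.- s) ℚ.- (t ℚ.* T ℚ.- s ℚ.* S)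
    identity = solve 7 (λ h K s t H S T →
      h :* (K :* (t :- s) :- (T :- S)) :+ (h :- t) :* (T :- S) :+ (H :- S) :* (t :- s)
        := (h :* K :+ H) :* (t :- s) :- (t :* T :- s :* S)) refl

even-^ : ∀ {n} → 2 ∣ n → ∀ p → (ℚ.- p) ^ n ≡ p ^ n
even-^ (divides zero    refl) p = refl
even-^ (divides (suc k) refl) p = trans (cong (λ t → ℚ.- p ℚ.* (ℚ.- p ℚ.* t)) (even-^ (divides k refl) p))
  (solve 2 (λ p t → :- p :* (:- p :* t) := p :* (p :* t)) refl p (p ^ (k ℕ.* 2)))

module SumOfPowers (a b : ℕ) where
  F : ℚ → ℚ
  F y = y ^ suc a ℚ.+ y ^ suc (suc b) ℚ.- 1ℚ

  -- The powers are at most `½` and `¼`, and `½ + ¼ - 1 = -¼`. This is the origin of the threshold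
  -- in `l-barrier`, and the reason the second exponent is kept at least 2: with both exponents 1
  -- the value at `½` would be 0.
  F≤-¼ : ∀ {t} → 0ℚ ℚ.≤ t → t ℚ.≤ ½ → F t ℚ.≤ ℚ.- ¼
  F≤-¼ {t} 0≤t t≤½ = ℚ.+-monoˡ-≤ (ℚ.- 1ℚ) (ℚ.+-mono-≤ (t*≤½* 1ℚ (t^≤1 a)) (t*≤½* ½ (t*≤½* 1ℚ (t^≤1 b))))
    where
    t^≤1 : ∀ k → t ^ k ℚ.≤ 1ℚ
    t^≤1 = p^k≤1 0≤t (ℚ.≤-trans t≤½ (from-yes (½ ℚ.≤? 1ℚ)))

    t*≤½* : ∀ {p} q .{{_ : ℚ.NonNegative q}} → p ℚ.≤ q → t ℚ.* p ℚ.≤ ½ ℚ.* q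
    t*≤½* q = *-mono-≤-nonNeg 0≤t (ℚ.nonNegative⁻¹ q) t≤½

  F-barrier : ∀ {t} → 0ℚ ℚ.≤ t → ℚ.- ¼ ℚ.< F t → ½ ℚ.≤ t
  F-barrier {t} 0≤t -¼<Ft with ℚ.≤-total t ½
  ... | inj₁ t≤½ = contradiction (ℚ.<-≤-trans -¼<Ft (F≤-¼ 0≤t t≤½)) (ℚ.<-irrefl refl)
  ... | inj₂ ½≤t = ½≤t

  F1≡1 : F 1ℚ ≡ 1ℚ
  F1≡1 = cong₂ (λ u v → u ℚ.+ v ℚ.- 1ℚ) (1^k≡1 (suc a)) (1^k≡1 (suc (suc b)))

  F-diff : ∀ {s t} → (t ^ suc a ℚ.- s ^ suc a) ℚ.+ (t ^ suc (suc b) ℚ.- s ^ suc (suc b)) ≡ F t ℚ.- F s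
  F-diff {s} {t} = identity (s ^ suc a) (s ^ suc (suc b)) (t ^ suc a) (t ^ suc (suc b))
    where
    identity : ∀ p q u v → (u ℚ.- p) ℚ.+ (v ℚ.- q) ≡ (u ℚ.+ v ℚ.- 1ℚ) ℚ.- (p ℚ.+ q ℚ.- 1ℚ)
    identity = solve 4 (λ p q u v → (u :- p) :+ (v :- q) := (u :+ v :- con 1ℚ) :- (p :+ q :- con 1ℚ)) refl

  -- The first power alone supplies the expansion; the second only has to be increasing.
  F-expanding : ∀ {s t} → ½ ℚ.≤ s → s ℚ.≤ t → ½ ^ a ℚ.* (t ℚ.- s) ℚ.≤ F t ℚ.- F s
  F-expanding {s} {t} ½≤s s≤t = subst₂ ℚ._≤_ (ℚ.+-identityʳ _) (F-diff {s} {t})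
    (ℚ.+-mono-≤ (^-expanding 0≤½ ½≤s s≤t a)
      (p≤q⇒0≤q-p (^-mono-≤ (ℚ.≤-trans 0≤½ ½≤s) s≤t (suc (suc b)))))

  private
    lipᵃ = ^-lipschitz (ℚ.positive⁻¹ 1ℚ) (suc a)
    lipᵇ = ^-lipschitz (ℚ.positive⁻¹ 1ℚ) (suc (suc b))

  F-lipschitz : ∀ {s t} → ½ ℚ.≤ s → s ℚ.≤ t → t ℚ.≤ 1ℚ →
    F t ℚ.- F s ℚ.≤ (proj₁ lipᵃ ℚ.+ proj₁ lipᵇ) ℚ.* (t ℚ.- s)
  F-lipschitz {s} {t} ½≤s s≤t t≤1 = subst₂ ℚ._≤_ (F-diff {s} {t})
    (sym (ℚ.*-distribʳ-+ (t ℚ.- s) (proj₁ lipᵃ) (proj₁ lipᵇ)))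
    (ℚ.+-mono-≤ (proj₂ (proj₂ lipᵃ) 0≤s s≤t t≤1) (proj₂ (proj₂ lipᵇ) 0≤s s≤t t≤1))
    where
    0≤s : 0ℚ ℚ.≤ s
    0≤s = ℚ.≤-trans 0≤½ ½≤s

  F-root : SimpleRoot F
  F-root = record
    { l = ½ ; h = 1ℚ ; c = ½ ^ a ; K = proj₁ lipᵃ ℚ.+ proj₁ lipᵇ
    ; l≤h       = from-yes (½ ℚ.≤? 1ℚ)
    ; g[l]<0    = ℚ.≤-<-trans (F≤-¼ 0≤½ ℚ.≤-refl) (ℚ.negative⁻¹ (ℚ.- ¼))
    ; 0<g[h]    = subst (0ℚ ℚ.<_) (sym F1≡1) (ℚ.positive⁻¹ 1ℚ)
    ; 0<c       = 0<^ (ℚ.positive⁻¹ ½) a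
    ; expanding = F-expanding
    ; 0<K       = ℚ.+-mono-< (proj₁ (proj₂ lipᵃ)) (proj₁ (proj₂ lipᵇ))
    ; lipschitz = F-lipschitz
    ; ½≤l       = ℚ.≤-refl
    ; l-barrier = F-barrier
    }

module ReflectedTrinomial (b : ℕ) where
  G : ℚ → ℚ
  G t = t ^ suc (suc b) ℚ.- t ℚ.- 1ℚ

  -- On `[0, 1]` the power is at most `t`, so `G` is at most -1 there, well below the threshold.
  G-barrier : ∀ {t} → 0ℚ ℚ.≤ t → ℚ.- ¼ ℚ.< G t → 1ℚ ℚ.≤ t
  G-barrier {t} 0≤t -¼<Gt with ℚ.≤-total t 1ℚ
  ... | inj₁ t≤1 = contradiction
        (ℚ.<-≤-trans -¼<Gt (ℚ.≤-trans G≤-1 (from-yes (ℚ.- 1ℚ ℚ.≤? ℚ.- ¼)))) (ℚ.<-irrefl refl)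
    where
    G≤-1 : G t ℚ.≤ ℚ.- 1ℚ
    G≤-1 = ≤-slack (t ℚ.* (1ℚ ℚ.- t ^ suc b)) (0≤-* 0≤t (p≤q⇒0≤q-p (p^k≤1 0≤t t≤1 (suc b))))
      (identity t (t ^ suc b))
      where
      identity : ∀ t T → t ℚ.* (1ℚ ℚ.- T) ≡ ℚ.- 1ℚ ℚ.- (t ℚ.* T ℚ.- t ℚ.- 1ℚ)
      identity = solve 2 (λ t T → t :* (con 1ℚ :- T) := :- con 1ℚ :- (t :* T :- t :- con 1ℚ)) refl
  ... | inj₂ 1≤t = 1≤t

  G1≡-1 : G 1ℚ ≡ ℚ.- 1ℚ
  G1≡-1 = cong (λ u → u ℚ.- 1ℚ ℚ.- 1ℚ) (1^k≡1 (suc (suc b)))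

  0<G2 : 0ℚ ℚ.< G 2ℚ
  -- The power of 2 is at least 4, and `4 - 2 - 1 = 1`.
  0<G2 = ℚ.<-≤-trans (ℚ.positive⁻¹ 1ℚ) (ℚ.+-monoˡ-≤ (ℚ.- 1ℚ) (ℚ.+-monoˡ-≤ (ℚ.- 2ℚ)
    (ℚ.*-monoˡ-≤-nonNeg 2ℚ (ℚ.*-monoˡ-≤-nonNeg 2ℚ (1≤p^k (from-yes (1ℚ ℚ.≤? 2ℚ)) b)))))

  -- t ^ (b + 2) has slope at least 2 on [1, ∞), which outweighs the term - t.
  G-expanding : ∀ {s t} → 1ℚ ℚ.≤ s → s ℚ.≤ t → 1ℚ ℚ.* (t ℚ.- s) ℚ.≤ G t ℚ.- G s
  G-expanding {s} {t} 1≤s s≤t = ≤-slack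
    ((t ^ suc b ℚ.- 1ℚ) ℚ.* (t ℚ.- s) ℚ.+ (s ℚ.- 1ℚ) ℚ.* (t ^ suc b ℚ.- s ^ suc b) ℚ.+ (t ^ suc b ℚ.- s ^ suc b ℚ.- 1ℚ ^ b ℚ.* (t ℚ.- s)))
    (0≤-+ (0≤-+ (0≤-* (p≤q⇒0≤q-p (1≤p^k (ℚ.≤-trans 1≤s s≤t) (suc b))) (p≤q⇒0≤q-p s≤t))
                (0≤-* (p≤q⇒0≤q-p 1≤s) (p≤q⇒0≤q-p (^-mono-≤ (ℚ.≤-trans 0≤1 1≤s) s≤t (suc b)))))
          (p≤q⇒0≤q-p (^-expanding 0≤1 1≤s s≤t b)))
    (trans (cong (λ u → (t ^ suc b ℚ.- 1ℚ) ℚ.* (t ℚ.- s) ℚ.+ (s ℚ.- 1ℚ) ℚ.* (t ^ suc b ℚ.- s ^ suc b) ℚ.+ (t ^ suc b ℚ.- s ^ suc b ℚ.- u ℚ.* (t ℚ.- s))) (1^k≡1 b))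
      (identity s t (s ^ suc b) (t ^ suc b)))
    where
    identity : ∀ s t S T →
      (T ℚ.- 1ℚ) ℚ.* (t ℚ.- s) ℚ.+ (s ℚ.- 1ℚ) ℚ.* (T ℚ.- S) ℚ.+ (T ℚ.- S ℚ.- 1ℚ ℚ.* (t ℚ.- s))
        ≡ (t ℚ.* T ℚ.- t ℚ.- 1ℚ) ℚ.- (s ℚ.* S ℚ.- s ℚ.- 1ℚ) ℚ.- 1ℚ ℚ.* (t ℚ.- s)
    identity = solve 4 (λ s t S T →
      (T :- con 1ℚ) :* (t :- s) :+ (s :- con 1ℚ) :* (T :- S) :+ (T :- S :- con 1ℚ :* (t :- s))
        := (t :* T :- t :- con 1ℚ) :- (s :* S :- s :- con 1ℚ) :- con 1ℚ :* (t :- s)) refl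

  private
    lip = ^-lipschitz (ℚ.positive⁻¹ 2ℚ) (suc (suc b))

  -- Subtracting `t` only lowers increments, so the constant of the power on `[0, 2]` serves.
  G-lipschitz : ∀ {s t} → 1ℚ ℚ.≤ s → s ℚ.≤ t → t ℚ.≤ 2ℚ → G t ℚ.- G s ℚ.≤ proj₁ lip ℚ.* (t ℚ.- s)
  G-lipschitz {s} {t} 1≤s s≤t t≤2 = ℚ.≤-trans
    (≤-slack (t ℚ.- s) (p≤q⇒0≤q-p s≤t) (identity s t (s ^ suc (suc b)) (t ^ suc (suc b))))
    (proj₂ (proj₂ lip) (ℚ.≤-trans 0≤1 1≤s) s≤t t≤2)
    where
    identity : ∀ s t S T → t ℚ.- s ≡ (T ℚ.- S) ℚ.- ((T ℚ.- t ℚ.- 1ℚ) ℚ.- (S ℚ.- s ℚ.- 1ℚ))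
    identity = solve 4 (λ s t S T → t :- s := (T :- S) :- ((T :- t :- con 1ℚ) :- (S :- s :- con 1ℚ))) refl

  G-root : SimpleRoot G
  G-root = record
    { l = 1ℚ ; h = 2ℚ ; c = 1ℚ ; K = proj₁ lip
    ; l≤h       = from-yes (1ℚ ℚ.≤? 2ℚ)
    ; g[l]<0    = subst (ℚ._< 0ℚ) (sym G1≡-1) (ℚ.negative⁻¹ (ℚ.- 1ℚ))
    ; 0<g[h]    = 0<G2
    ; 0<c       = ℚ.positive⁻¹ 1ℚ
    ; expanding = G-expanding
    ; 0<K       = proj₁ (proj₂ lip)
    ; lipschitz = G-lipschitz
    ; ½≤l       = from-yes (½ ℚ.≤? 1ℚ)
    ; l-barrier = G-barrier
    }

-- Parity of the exponents and the two cases of the theorem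

odd⇒2∣pred : ∀ n → ¬ (2 ∣ suc n) → 2 ∣ n
odd⇒2∣pred zero          _ = divides 0 refl
odd⇒2∣pred (suc zero)    2∤2 = contradiction (divides 1 refl) 2∤2
odd⇒2∣pred (suc (suc n)) 2∤ with odd⇒2∣pred n (λ { (divides k eq) → 2∤ (divides (suc k) (cong (2 ℕ.+_) eq)) })
... | divides k refl = divides (suc k) refl

TwoZerosIn : Polynomial → ℤ → ℤ → ℤ → ℤ → Set
TwoZerosIn P i j k l = ∃₂ λ x y → ExactlyTwoZeros P x y × InInterval i j x × InInterval k l y

-- `F` is an even function, so `F-root` serves on both sides. The bracket from `½` to 1 becomes
-- `(-½, 0)` under `y - 1` and `(-2, -3/2)` under `- t - 1`.
zeros-both-even : ∀ P {a b} → 2 ∣ suc a → 2 ∣ suc (suc b) →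
  (∀ r → evalℚ P r ≡ SumOfPowers.F a b (1ℚ ℚ.+ r)) → TwoZerosIn P (- (+ 1)) (+ 0) (- (+ 2)) (- (+ 1))
zeros-both-even P {a} {b} 2∣a+1 2∣b+2 P≗F =
  x⁺ , x⁻ , exactly-two-zeros ,
  x⁺-interval { - (+ 1)} {+ 0} (from-yes (ℚ.- 1ℚ ℚ.≤? ½ ℚ.- 1ℚ)) ℚ.≤-refl ,
  x⁻-interval { - (+ 2)} { - (+ 1)} ℚ.≤-refl (from-yes (ℚ.- ½ ℚ.- 1ℚ ℚ.≤? ℚ.- 1ℚ))
  where
  open SumOfPowers a b

  P≗F⁻ : ∀ r → evalℚ P r ≡ F (ℚ.- (1ℚ ℚ.+ r))
  P≗F⁻ r = trans (P≗F r) (cong₂ (λ u v → u ℚ.+ v ℚ.- 1ℚ)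
    (sym (even-^ 2∣a+1 (1ℚ ℚ.+ r))) (sym (even-^ 2∣b+2 (1ℚ ℚ.+ r))))

  open TwoZeros P F-root F-root P≗F P≗F⁻

-- The odd exponent 1 breaks the symmetry: reflection turns `F` into `G`, and the bracket from 1 to
-- 2 becomes exactly `(-3, -2)`.
zeros-linear+even : ∀ P {b} → 2 ∣ suc (suc b) →
  (∀ r → evalℚ P r ≡ SumOfPowers.F 0 b (1ℚ ℚ.+ r)) → TwoZerosIn P (- (+ 1)) (+ 0) (- (+ 3)) (- (+ 2))
zeros-linear+even P {b} 2∣b+2 P≗F =
  x⁺ , x⁻ , exactly-two-zeros ,
  x⁺-interval { - (+ 1)} {+ 0} (from-yes (ℚ.- 1ℚ ℚ.≤? ½ ℚ.- 1ℚ)) ℚ.≤-refl ,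
  x⁻-interval { - (+ 3)} { - (+ 2)} ℚ.≤-refl ℚ.≤-refl
  where
  open SumOfPowers 0 b
  open ReflectedTrinomial b

  -- The factor `1ℚ` is what remains of the first power, which unfolds to `u * 1ℚ`.
  identity : ∀ u T → u ℚ.* 1ℚ ℚ.+ T ℚ.- 1ℚ ≡ T ℚ.- ℚ.- u ℚ.- 1ℚ
  identity = solve 2 (λ u T → u :* con 1ℚ :+ T :- con 1ℚ := T :- :- u :- con 1ℚ) refl

  P≗G : ∀ r → evalℚ P r ≡ G (ℚ.- (1ℚ ℚ.+ r))
  P≗G r = trans (P≗F r) (trans (identity (1ℚ ℚ.+ r) ((1ℚ ℚ.+ r) ^ suc (suc b)))
    (cong (λ T → T ℚ.- ℚ.- (1ℚ ℚ.+ r) ℚ.- 1ℚ) (sym (even-^ 2∣b+2 (1ℚ ℚ.+ r)))))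

  open TwoZeros P F-root G-root P≗F P≗G

theorem2p3 : (p q : ℕ) → Prime p → Prime q → p <ℕ q →
    (¬ (2 ∣ p) → ¬ (2 ∣ q) →
    ∃₂ λ x y → ExactlyTwoZeros (I (Γ (p *ℕ q))) x y ×
    InInterval (- (+ 1)) (+ 0) x × InInterval (- (+ 2)) (- (+ 1)) y) ×
    (p ≡ 2 → ¬ (2 ∣ q) →
    ∃₂ λ x y → ExactlyTwoZeros (I (Γ (p *ℕ q))) x y ×
    InInterval (- (+ 1)) (+ 0) x × InInterval (- (+ 3)) (- (+ 2)) y)
theorem2p3 p q p-prime q-prime p<q =
  (λ 2∤p 2∤q → zeros-both-even (I (Γ (p *ℕ q))) (2∣pred 2+a≡p 2∤p) (2∣pred 3+b≡q 2∤q) (evalℚ-I-Γ p-prime q-prime p<q 2+a≡p 3+b≡q)) ,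
  (λ p≡2 2∤q → zeros-linear+even (I (Γ (p *ℕ q))) (2∣pred 3+b≡q 2∤q) (evalℚ-I-Γ p-prime q-prime p<q (sym p≡2) 3+b≡q))
  where
  2≤p : 2 ℕ.≤ p
  2≤p = prime>1 p-prime

  2+a≡p : 2 ℕ.+ (p ℕ.∸ 2) ≡ p
  2+a≡p = ℕ.m+[n∸m]≡n 2≤p

  -- From `2 ≤ p < q` follows `3 ≤ q`, so the exponent `q - 1` has the form `b + 2`.
  3+b≡q : 3 ℕ.+ (q ℕ.∸ 3) ≡ q
  3+b≡q = ℕ.m+[n∸m]≡n (ℕ.≤-trans (s≤s 2≤p) p<q)

  2∣pred : ∀ {m n} → suc m ≡ n → ¬ (2 ∣ n) → 2 ∣ m
  2∣pred {m} refl = odd⇒2∣pred m
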